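{- Let $\mathcal{F}_5$ be the family of all cyclically $5$-edge-connected snarks and let $\mathcal{F}_4$ be the family of all cyclically $4$-edge-connected snarks having a planarizing perfect pseudo-matching (graphs in both families being considered up to isomorphism). For each $G\in\mathcal{F}_5$, with a given perfect pseudo-matching $M_G$ of $G$, let a drawing of $G$ in the plane with $M_G$-avoiding intersections be given, and let $G^*$ be the cubic graph constructed from this drawing by replacing every crossing by a copy of the Blanuša block $B_0$ (as described in the context). Define a mapping $f:\mathcal{F}_5\to\mathcal{F}_4$ by setting $f(G)=G^*$. Then $f$ is injective.
   Context: A cubic graph is cyclically $k$-edge-connected if it is connected and has no edge cut with fewer than $k$ edges whose removal leaves at least two components containing cycles. A snark is a cyclically $4$-edge-connected cubic graph that is not $3$-edge-colorable (no girth requirement). A perfect pseudo-matching $M$ in a graph $G$ is a collection of vertex-disjoint subgraphs of $G$, each isomorphic to $K_2$ or $K_{1,3}$, whose vertex sets together cover $V(G)$; $E(M)$ denotes the set of edges of its members. $G/M$ is the (multi)graph obtained by contracting each member of $M$ to a single vertex (the edges of $E(M)$ disappear; all other edges are kept, possibly becoming loops or parallel edges). $M$ is planarizing if $G/M$ is planar. A drawing of $G$ in the plane with $M$-avoiding intersections is a drawing in which the crossings involve only edges of $E(G)\setminus E(M)$ and no three edges of $G$ cross each other in the same point of the plane. (Every simple cubic graph with a given perfect pseudo-matching $M$ has such a drawing.) The Blanuša block $B_0$ has vertices $u_0,\dots,u_7$, edges $u_0u_1,u_1u_2,u_3u_4,u_5u_6,u_6u_7,u_0u_3,u_3u_5,u_1u_6,u_2u_4,u_4u_7$,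 and four half-edges: $a$ at $u_0$, $b$ at $u_5$, $b'$ at $u_2$, $a'$ at $u_7$. Replacing a crossing: if edges $xx'''$ and $x'x''$ cross, delete both edges, add a (new, disjoint) copy of $B_0$ drawn near the crossing point, and connect $x$ with $a$, $x'''$ with $a'$, $x'$ with $b$ and $x''$ with $b'$ (i.e. add edges from $x,x''',x',x''$ to the vertices carrying the respective half-edges), the new edges following the four pieces of the old edges. The graph $G^*$ is obtained by doing this repeatedly for all crossings of the drawing; an edge with several crossings thus passes through several copies of $B_0$ in the order of its crossings, the half-edges $a,a'$ being used for one of the two crossing edges and $b,b'$ for the other. -}

module Defs where

open import Data.Bool.Base using (Bool; true; false; not; _xor_)
open import Data.Fin.Base using (Fin; zero; suc)
open import Data.Fin.Patterns
open import Data.Fin.Relation.Unary.Top using (view; ‵fromℕ; ‵inject₁)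
open import Data.List.Base using (List; []; _∷_; length)
open import Data.List.Membership.Propositional using (_∈_)
open import Data.List.Relation.Unary.Unique.Propositional using (Unique)
open import Data.Nat.Base using (ℕ; zero; suc; _+_; _*_; _<_)
open import Data.Product.Base using (∃-syntax; _×_; _,_; proj₁; proj₂)
open import Data.Refinement.Base using (Refinement-syntax; value)
open import Data.Sum.Base using (_⊎_; inj₁; inj₂)
open import Data.Vec.Base using (Vec; []; _∷_; lookup)
open import Function.Bundles using (_↔_; _⇔_; module Inverse)
open import Function.Definitions using (Injective; Surjective; Bijective)
open import Relation.Binary.Construct.Closure.Equivalence using (EqClosure)
open import Relation.Binary.PropositionalEquality.Core using (_≡_; _≢_)
open import Relation.Nullary.Negation.Core using (¬_)

------------------------------------------------------------------------
-- Multigraphs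

-- Loops and parallel edges are allowed.  The order of the two ends of an
-- edge is only a naming device: homomorphisms may exchange them.

record Graph : Set₁ where
  field
    V    : Set
    E    : Set
    ends : E → Bool → V

open Graph public

Finite : Graph → Set
Finite G = (∃[ n ] (V G ↔ Fin n)) × (∃[ m ] (E G ↔ Fin m))

record Hom (G H : Graph) : Set where
  field
    onV       : V G → V H
    onE       : E G → E H
    ends-resp : ∀ e →
      (∀ s → ends H (onE e) s ≡ onV (ends G e s)) ⊎
      (∀ s → ends H (onE e) s ≡ onV (ends G e (not s)))

open Hom public

-- Subgraphs of H isomorphic to G.
record _↪_ (G H : Graph) : Set where
  field
    hom           : Hom G H
    onV-injective : Injective _≡_ _≡_ (onV hom)
    onE-injective : Injective _≡_ _≡_ (onE hom)

open _↪_ public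

infix 4 _≅_

record _≅_ (G H : Graph) : Set where
  field
    iso           : Hom G H
    onV-bijective : Bijective _≡_ _≡_ (onV iso)
    onE-bijective : Bijective _≡_ _≡_ (onE iso)

-- The dart (e , s) is the edge e traversed starting from its end s.

Dart : Graph → Set
Dart G = E G × Bool

tail : (G : Graph) → Dart G → V G
tail G (e , s) = ends G e s

opposite : (G : Graph) → Dart G → Dart G
opposite G (e , s) = e , not s

head : (G : Graph) → Dart G → V G
head G d = tail G (opposite G d)

delete : (G : Graph) → (E G → Set) → Graph
delete G P = record
  { V    = V G
  ; E    = [ e ∈ E G ∣ ¬ P e ]
  ; ends = λ e → ends G (value e)
  }

------------------------------------------------------------------------
-- Walks, cycles and connectivity

data Walk (G : Graph) : V G → V G → Set where
  []  : ∀ {v} → Walk G v v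
  _∷_ : ∀ {v} (d : Dart G) → Walk G (head G d) v → Walk G (tail G d) v

walkEdges : ∀ {G u v} → Walk G u v → List (E G)
walkEdges []      = []
walkEdges (d ∷ w) = proj₁ d ∷ walkEdges w

-- The final vertex of the walk is not listed.
walkVertices : ∀ {G u v} → Walk G u v → List (V G)
walkVertices         []      = []
walkVertices {G = G} (d ∷ w) = tail G d ∷ walkVertices w

-- Distinctness of the edges matters only for length two, where it excludes
-- going back and forth along one edge.
record CycleAt (G : Graph) (v : V G) : Set where
  field
    walk            : Walk G v v
    nonempty        : walkEdges walk ≢ []
    unique-edges    : Unique (walkEdges walk)
    unique-vertices : Unique (walkVertices walk)

Connected : Graph → Set
Connected G = ∀ u v → Walk G u v

TwoCyclicComponents : Graph → Set
TwoCyclicComponents G =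
  ∃[ u ] ∃[ v ] CycleAt G u × CycleAt G v × ¬ Walk G u v

-- Repetitions in S are harmless: they only make S longer.
CyclicallyEdgeConnected : ℕ → Graph → Set
CyclicallyEdgeConnected k G =
  Connected G ×
  (∀ (S : List (E G)) → length S < k → ¬ TwoCyclicComponents (delete G (_∈ S)))

------------------------------------------------------------------------
-- Snarks

Cubic : Graph → Set
Cubic G = ∀ v → (∃[ d ] tail G d ≡ v) ↔ Fin 3

ThreeEdgeColorable : Graph → Set
ThreeEdgeColorable G =
  ∃[ c ] (∀ (d d′ : Dart G) → d ≢ d′ → tail G d ≡ tail G d′ →
          colour c d ≢ colour c d′)
  where
  colour : (E G → Fin 3) → Dart G → Fin 3
  colour c d = c (proj₁ d)

record Snark (G : Graph) : Set where
  field
    finite                      : Finite G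
    cubic                       : Cubic G
    cyclically-4-edge-connected : CyclicallyEdgeConnected 4 G
    not-3-edge-colorable        : ¬ ThreeEdgeColorable G

------------------------------------------------------------------------
-- Planarity

-- c exhibits Fin n as the quotient of A by the equivalence generated by R.
record Classes {A : Set} (R : A → A → Set) (n : ℕ) : Set where
  field
    class      : A → Fin n
    surjective : Surjective _≡_ _≡_ class
    exact      : ∀ x y → (class x ≡ class y) ⇔ EqClosure R x y

-- Embeddings in the sphere, given as rotation systems of genus zero: the
-- permutation next sends a dart to the one following it around its tail.
-- Faces are the orbits of next ∘ opposite, and Euler's formula is used in
-- its form for hypermaps, with the number of darts being twice the number
-- of edges.  Isolated vertices carry no darts and play no role.
record PlaneEmbedding (G : Graph) : Set where
  field
    next : Dart G ↔ Dart G

  nextStep : Dart G → Dart G → Set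
  nextStep d d′ = Inverse.to next d ≡ d′

  edgeStep : Dart G → Dart G → Set
  edgeStep d d′ = opposite G d ≡ d′

  faceStep : Dart G → Dart G → Set
  faceStep d d′ = Inverse.to next (opposite G d) ≡ d′

  step : Dart G → Dart G → Set
  step d d′ = nextStep d d′ ⊎ edgeStep d d′

  field
    rotation : ∀ d d′ → EqClosure nextStep d d′ ⇔ (tail G d ≡ tail G d′)
    #darts #vertices #edges #faces #components : ℕ
    darts      : Dart G ↔ Fin #darts
    vertices   : Classes nextStep #vertices
    edges      : Classes edgeStep #edges
    faces      : Classes faceStep #faces
    components : Classes step #components
    euler      : #vertices + #edges + #faces ≡ #darts + 2 * #components

Planar : Graph → Set
Planar = PlaneEmbedding

------------------------------------------------------------------------
-- Perfect pseudo-matchings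

K₂ K₁,₃ : Graph
K₂ = record
  { V    = Fin 2
  ; E    = Fin 1
  ; ends = λ { _ false → 0F ; _ true → 1F }
  }
K₁,₃ = record
  { V    = Fin 4
  ; E    = Fin 3
  ; ends = λ { _ false → 0F ; i true → suc i }
  }

data Shape : Set where
  edge claw : Shape

shapeGraph : Shape → Graph
shapeGraph edge = K₂
shapeGraph claw = K₁,₃

record PerfectPseudoMatching (G : Graph) : Set where
  field
    size   : ℕ
    shape  : Fin size → Shape
    member : ∀ i → shapeGraph (shape i) ↪ G

  memberVertex : (∃[ i ] V (shapeGraph (shape i))) → V G
  memberVertex (i , x) = onV (hom (member i)) x

  -- Injectivity: the members are disjoint.  Surjectivity: they cover V G.
  field
    partition : Bijective _≡_ _≡_ memberVertex

  InE : E G → Set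
  InE e = ∃[ i ] ∃[ x ] onE (hom (member i)) x ≡ e

  memberOf : V G → Fin size
  memberOf v = proj₁ (proj₁ (proj₂ partition v))

open PerfectPseudoMatching public using (InE)

_/_ : (G : Graph) → PerfectPseudoMatching G → Graph
G / M = record
  { V    = Fin (PerfectPseudoMatching.size M)
  ; E    = E (delete G (InE M))
  ; ends = λ e s →
      PerfectPseudoMatching.memberOf M (ends (delete G (InE M)) e s)
  }

Planarizing : {G : Graph} → PerfectPseudoMatching G → Set
Planarizing {G} M = Planar (G / M)

------------------------------------------------------------------------
-- Drawings

-- The incidences between edges and crossings in a drawing.  Every crossing
-- has two strands, and (e , i) ↦ pass (e , i) lists the strands that make up
-- the edge e, in order from the end false of e to its end true.  Which
-- strand of a crossing is called false is arbitrary.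
record Crossings (G : Graph) : Set where
  field
    #crossings : ℕ
    #passes    : E G → ℕ
    pass       : (∃[ e ] Fin (#passes e)) ↔ (Fin #crossings × Bool)

  edgeAt : Fin #crossings → Bool → E G
  edgeAt c s = proj₁ (Inverse.from pass (c , s))

  field
    two-edges : ∀ c → edgeAt c false ≢ edgeAt c true

  -- (e , i) is the part of e between its i-th and (i+1)-st crossing, where
  -- the 0-th and the last "crossing" are the ends of e.
  Piece : Set
  Piece = ∃[ e ] Fin (suc (#passes e))

  -- ((c , s) , t) is the side of the strand s at the crossing c which is
  -- nearer, along the edge containing it, to the end t of that edge.
  Side : Set
  Side = (Fin #crossings × Bool) × Bool

  pieceEnd : Piece → Bool → V G ⊎ Side
  pieceEnd (e , zero)  false = inj₁ (ends G e false)
  pieceEnd (e , suc i) false = inj₂ (Inverse.to pass (e , i) , true)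
  pieceEnd (e , i)     true  with view i
  ... | ‵fromℕ     = inj₁ (ends G e true)
  ... | ‵inject₁ j = inj₂ (Inverse.to pass (e , j) , false)

  planarization : Graph
  planarization = record
    { V    = V G ⊎ Fin #crossings
    ; E    = Piece
    ; ends = λ p t → point (pieceEnd p t)
    }
    where
    point : V G ⊎ Side → V G ⊎ Fin #crossings
    point (inj₁ v)             = inj₁ v
    point (inj₂ ((c , _) , _)) = inj₂ c

-- A drawing in the plane with M-avoiding intersections, described by the
-- plane graph obtained by turning every crossing into a vertex.  Only two
-- edges meet at a crossing, and they do so transversally: their strands
-- alternate around it.
record Drawing (G : Graph) (M : PerfectPseudoMatching G) : Set where
  field
    crossings : Crossings G

  open Crossings crossings

  field
    avoiding    : ∀ c s → ¬ InE M (edgeAt c s)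
    embedding   : PlaneEmbedding planarization
    transversal : ∀ p t p′ t′ c s s′ r r′ →
      Inverse.to (PlaneEmbedding.next embedding) (p , t) ≡ (p′ , t′) →
      pieceEnd p  t  ≡ inj₂ ((c , s ) , r ) →
      pieceEnd p′ t′ ≡ inj₂ ((c , s′) , r′) →
      s ≢ s′

------------------------------------------------------------------------
-- Replacing crossings by Blanuša blocks

B₀ : Graph
B₀ = record
  { V    = Fin 8
  ; E    = Fin 10
  ; ends = λ { e false → proj₁ (lookup uv e) ; e true → proj₂ (lookup uv e) }
  }
  where
  uv : Vec (Fin 8 × Fin 8) 10
  uv = (0F , 1F) ∷ (1F , 2F) ∷ (3F , 4F) ∷ (5F , 6F) ∷ (6F , 7F)
     ∷ (0F , 3F) ∷ (3F , 5F) ∷ (1F , 6F) ∷ (2F , 4F) ∷ (4F , 7F) ∷ []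

data HalfEdge : Set where
  a a′ b b′ : HalfEdge

foot : HalfEdge → V B₀
foot a  = 0F
foot b  = 5F
foot b′ = 2F
foot a′ = 7F

-- The choices left open when replacing a crossing: which of its strands
-- uses a and a′, and in which direction each of them runs through the block.
record Wiring (k : ℕ) : Set where
  field
    exchange : Fin k → Bool
    reverse  : Fin k → Bool → Bool

  halfEdge : Fin k → Bool → Bool → HalfEdge
  halfEdge c s t = choose (s xor exchange c) (t xor reverse c s)
    where
    choose : Bool → Bool → HalfEdge
    choose false false = a
    choose false true  = a′
    choose true  false = b
    choose true  true  = b′

replaceCrossings : {G : Graph} (X : Crossings G) →
                   Wiring (Crossings.#crossings X) → Graph
replaceCrossings {G} X ρ = record
  { V    = V G ⊎ Fin #crossings × V B₀
  ; E    = Piece ⊎ Fin #crossings × E B₀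
  ; ends = λ { (inj₁ p)       t → attach (pieceEnd p t)
             ; (inj₂ (c , e)) t → inj₂ (c , ends B₀ e t) }
  }
  where
  open Crossings X
  attach : V G ⊎ Side → V G ⊎ Fin #crossings × V B₀
  attach (inj₁ v)             = inj₁ v
  attach (inj₂ ((c , s) , t)) = inj₂ (c , foot (Wiring.halfEdge ρ c s t))

record WiredDrawing (G : Graph) (M : PerfectPseudoMatching G) : Set where
  field
    drawing : Drawing G M
    wiring  : Wiring (Crossings.#crossings (Drawing.crossings drawing))

_* : {G : Graph} {M : PerfectPseudoMatching G} → WiredDrawing G M → Graph
D * = replaceCrossings (Drawing.crossings drawing) wiring
  where open WiredDrawing D

------------------------------------------------------------------------
-- The two families

record 𝓕₅ : Set₁ where
  field
    graph                       : Graph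
    snark                       : Snark graph
    cyclically-5-edge-connected : CyclicallyEdgeConnected 5 graph

record 𝓕₄ : Set₁ where
  field
    graph       : Graph
    snark       : Snark graph
    matching    : PerfectPseudoMatching graph
    planarizing : Planarizing matching

infix 4 _≅₅_ _≅₄_

_≅₅_ : 𝓕₅ → 𝓕₅ → Set
G ≅₅ H = 𝓕₅.graph G ≅ 𝓕₅.graph H

_≅₄_ : 𝓕₄ → 𝓕₄ → Set
G ≅₄ H = 𝓕₄.graph G ≅ 𝓕₄.graph H

{-# OPTIONS --safe #-}

-- Call the copies of B₀ inserted by a drawing the blocks of G*, and compare the
-- blocks of two graphs G and H with G* ≅ H*.  If two of them overlap without being
-- equal, then some vertex outside one of them is joined to it by two edges, and the
-- three remaining edges around that block and this vertex form a forbidden cut of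
-- G*.  Hence each block of G* is a block of H* or lies entirely in H, and in the
-- latter case cyclic 5-edge-connectivity leaves at most two other vertices in H, so
-- that H is the Petersen graph, the other possibilities being 3-edge-colourable.
-- If all blocks match, then G and H are both recovered from the common graph by
-- joining a with a′ and b with b′: these are the only pairs of half-edges whose feet
-- have no common neighbour in B₀.  If a block lies in H and all blocks of H* are
-- blocks of G*, then G has at most two vertices, which is impossible.

module Submission where

open import Defs
open import Data.Bool.Base using (Bool; true; false; not; _xor_)
import Data.Bool.Properties as Bool
open import Data.Empty using (⊥; ⊥-elim; ⊥-elim-irr)
open import Data.Fin.Base using (Fin; zero; suc; fromℕ; inject₁; toℕ)
import Data.Fin.Base as Finᵇ
open import Data.Fin.Induction using (<-weakInduction)
open import Data.Fin.Patterns
import Data.Fin.Properties as Fin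
open import Data.Fin.Relation.Unary.Top using (View; view; ‵fromℕ; ‵inject₁; view-fromℕ; view-inject₁)
open import Data.Irrelevant using ([_])
open import Data.List.Base using (List; []; _∷_; length; _++_; filter; allFin; map; cartesianProduct)
import Data.List.Membership.DecPropositional as DecMembership
open import Data.List.Membership.Propositional using (_∈_; _∉_; find; lose)
open import Data.List.Membership.Propositional.Properties using (∈-∃++; ∈-map⁺; ∈-map⁻; ∈-allFin; ∈-filter⁺; ∈-filter⁻)
open import Data.List.Properties using (length-map)
open import Data.List.Relation.Binary.Permutation.Propositional using (_↭_; ↭-sym; ↭-trans; ↭⇒↭ₛ; prep)
open import Data.List.Relation.Binary.Permutation.Propositional.Properties using (shift; ∈-resp-↭; ↭-length)
open import Data.List.Relation.Binary.Permutation.Setoid.Properties using (Unique-resp-↭)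
open import Data.List.Relation.Binary.Subset.Propositional using (_⊆_)
open import Data.List.Relation.Unary.All using ([]; _∷_)
open import Data.List.Relation.Unary.All.Properties using (¬Any⇒All¬; All¬⇒¬Any)
open import Data.List.Relation.Unary.AllPairs using ([]; _∷_; allPairs?)
open import Data.List.Relation.Unary.Any using (Any; here; there; any?)
open import Data.List.Relation.Unary.Unique.Propositional using (Unique)
import Data.List.Relation.Unary.Unique.Propositional.Properties as Unique
open import Data.Maybe.Base using (Maybe; just; nothing)
open import Data.Maybe.Properties using (just-injective)
open import Data.Nat.Base using (ℕ; zero; suc; _+_; _≤_; _<_; z≤n; s≤s)
import Data.Nat.Properties as ℕ
open import Data.Product.Base using (∃-syntax; ∃₂; _×_; _,_; proj₁; proj₂)
import Data.Product.Properties as Product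
open import Data.Refinement.Base using (value; _,_)
open import Data.Sum.Base as Sum using (_⊎_; inj₁; inj₂)
open import Data.Sum.Properties using (inj₁-injective; inj₂-injective)
open import Data.Unit.Base using (⊤; tt)
open import Data.Vec.Base using (Vec; []; _∷_; lookup; tabulate)
open import Data.Vec.Properties using (lookup∘tabulate)
open import Function.Base using (_∘_; id; case_of_)
open import Function.Bundles using (_↔_; module Inverse)
open import Function.Definitions using (Injective)
open import Relation.Binary.Definitions using (DecidableEquality)
open import Relation.Binary.PropositionalEquality using (_≡_; _≢_; refl; sym; trans; cong; cong₂; subst; setoid)
open import Relation.Nullary.Decidable using (Dec; yes; no; ¬?; _×-dec_; map′; decidable-stable; _⊎-dec_; from-yes; does)
open import Relation.Nullary.Negation.Core using (¬_; contradiction)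

-- Every cut argument rests on one count. If `n` vertices of a cubic graph span a forest with `c`
-- components, they span `n - c` edges, and `n + 2c` edges leave them. When `S` separates a nonempty
-- vertex set from a cycle and is too small for the cyclic connectivity, that set spans no cycle, so
-- `S` has at least `n + 2` members. For cuts around a block the cycle on the other side is a
-- pentagon of the block; hence two edges cut off no vertex, three at most one, four at most two. In
-- the common graph cuts of three edges suffice, and cyclic 4-edge-connectivity forbids these; in
-- `H` all four legs of a block are cut, and this takes cyclic 5-edge-connectivity.
--
-- The matching of blocks is shaped by the symmetries of `B₀`: it has automorphisms, even some that
-- exchange the pair `a`, `a′` with the pair `b`, `b′`. Two blocks on the same vertices may
-- therefore name their half-edges differently, and the strands must be recognised from the bare
-- graph.

-- Lists without repetitions

module _ {A : Set} where

  Unique-∉ : ∀ {x : A} {xs} → Unique (x ∷ xs) → x ∉ xs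
  Unique-∉ (x∉ ∷ _) = All¬⇒¬Any x∉

  ∉-Unique : ∀ {x : A} {xs} → x ∉ xs → Unique xs → Unique (x ∷ xs)
  ∉-Unique x∉ u = ¬Any⇒All¬ _ x∉ ∷ u

  Unique-tail : ∀ {x : A} {xs} → Unique (x ∷ xs) → Unique xs
  Unique-tail (_ ∷ u) = u

  extract : ∀ {x : A} {xs} → x ∈ xs → ∃[ ys ] xs ↭ x ∷ ys
  extract {x} x∈ with ys , zs , refl ← ∈-∃++ x∈ = ys ++ zs , shift x ys zs

  Unique-↭ : ∀ {xs ys : List A} → xs ↭ ys → Unique xs → Unique ys
  Unique-↭ p = Unique-resp-↭ (setoid A) (↭⇒↭ₛ p)

  Unique-⊆-length : ∀ {xs ys : List A} → Unique xs → xs ⊆ ys → length xs ≤ length ys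
  Unique-⊆-length {[]} u sub = z≤n
  Unique-⊆-length {x ∷ xs} {ys} u sub with zs , p ← extract (sub (here refl)) =
    ℕ.≤-trans (s≤s (Unique-⊆-length (Unique-tail u) sub′)) (ℕ.≤-reflexive (sym (↭-length p)))
    where
    sub′ : xs ⊆ zs
    sub′ y∈ with ∈-resp-↭ p (sub (there y∈))
    ... | here refl = contradiction y∈ (Unique-∉ u)
    ... | there y∈zs = y∈zs

-- Darts

opposite² : (G : Graph) (d : Dart G) → opposite G (opposite G d) ≡ d
opposite² G (e , false) = refl
opposite² G (e , true)  = refl

opposite≢ : (G : Graph) (d : Dart G) → opposite G d ≢ d
opposite≢ G (e , false) ()
opposite≢ G (e , true)  ()

same-edge : (G : Graph) (d d′ : Dart G) → proj₁ d ≡ proj₁ d′ → d′ ≡ d ⊎ d′ ≡ opposite G d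
same-edge G (e , false) (e , false) refl = inj₁ refl
same-edge G (e , false) (e , true)  refl = inj₂ refl
same-edge G (e , true)  (e , false) refl = inj₂ refl
same-edge G (e , true)  (e , true)  refl = inj₁ refl

-- Finite types and finite cubic graphs

module _ {n : ℕ} {A : Set} (A↔ : A ↔ Fin n) where
  open Inverse A↔

  ↔-from-injective : ∀ {i j} → from i ≡ from j → i ≡ j
  ↔-from-injective {i} {j} eq = trans (sym (inverseˡ refl)) (inverseˡ eq)

  ↔-to-injective : ∀ {x y} → to x ≡ to y → x ≡ y
  ↔-to-injective {x} {y} eq = trans (sym (inverseʳ refl)) (inverseʳ eq)

  ↔-≟ : DecidableEquality A
  ↔-≟ x y = map′ ↔-to-injective (cong to) (to x Fin.≟ to y)

  enum : List A
  enum = map from (allFin n)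

  ∈-enum : ∀ x → x ∈ enum
  ∈-enum x = subst (_∈ enum) (inverseʳ refl) (∈-map⁺ from (∈-allFin (to x)))

  enum-Unique : Unique enum
  enum-Unique = Unique.map⁺ ↔-from-injective (Unique.allFin⁺ n)

  ↔-any? : ∀ {P : A → Set} → (∀ x → Dec (P x)) → Dec (∃[ x ] P x)
  ↔-any? {P} P? = map′ (λ (i , p) → from i , p)
                   (λ (x , p) → to x , subst P (sym (inverseʳ refl)) p)
                   (Fin.any? (P? ∘ from))

record FiniteCubic (G : Graph) : Set where
  field
    finite : Finite G
    cubic  : Cubic G

  infix 4 _≟ⱽ_ _≟ᴱ_ _≟ᴰ_
  _≟ⱽ_ : DecidableEquality (V G)
  _≟ⱽ_ = ↔-≟ (proj₂ (proj₁ finite))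
  _≟ᴱ_ : DecidableEquality (E G)
  _≟ᴱ_ = ↔-≟ (proj₂ (proj₂ finite))
  _≟ᴰ_ : DecidableEquality (Dart G)
  _≟ᴰ_ = Product.≡-dec _≟ᴱ_ Bool._≟_

  allV : List (V G)
  allV = enum (proj₂ (proj₁ finite))
  ∈-allV : ∀ v → v ∈ allV
  ∈-allV = ∈-enum (proj₂ (proj₁ finite))
  allV-Unique : Unique allV
  allV-Unique = enum-Unique (proj₂ (proj₁ finite))

  anyV? : ∀ {P : V G → Set} → (∀ x → Dec (P x)) → Dec (∃[ x ] P x)
  anyV? = ↔-any? (proj₂ (proj₁ finite))

  dart : V G → Fin 3 → Dart G
  dart v i = proj₁ (Inverse.from (cubic v) i)

  tail-dart : ∀ v i → tail G (dart v i) ≡ v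
  tail-dart v i = proj₂ (Inverse.from (cubic v) i)

  index : ∀ {v} d → tail G d ≡ v → Fin 3
  index {v} d p = Inverse.to (cubic v) (d , p)

  dart-index : ∀ {v} d (p : tail G d ≡ v) → dart v (index d p) ≡ d
  dart-index {v} d p = cong proj₁ (Inverse.inverseʳ (cubic v) refl)

  index-injective : ∀ {v} {d d′} (p : tail G d ≡ v) (p′ : tail G d′ ≡ v) →
                    index d p ≡ index d′ p′ → d ≡ d′
  index-injective p p′ eq = trans (sym (dart-index _ p)) (trans (cong (dart _) eq) (dart-index _ p′))

  dart-injective : ∀ {v i j} → dart v i ≡ dart v j → i ≡ j
  dart-injective {v} {i} {j} eq = ↔-from-injective (cubic v) (pair (tail-dart v i) (tail-dart v j) eq)
    where
    pair : ∀ {d d′} (p : tail G d ≡ v) (p′ : tail G d′ ≡ v) → d ≡ d′ →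
           _≡_ {A = ∃[ d ] tail G d ≡ v} (d , p) (d′ , p′)
    pair refl refl refl = refl

  record Third (v : V G) (d₁ d₂ : Dart G) : Set where
    field
      d₃    : Dart G
      at₃   : tail G d₃ ≡ v
      ≢₁    : d₃ ≢ d₁
      ≢₂    : d₃ ≢ d₂
      three : ∀ d → tail G d ≡ v → d ≡ d₁ ⊎ d ≡ d₂ ⊎ d ≡ d₃

  thirdIndex : ∀ (i j : Fin 3) → i ≢ j →
               ∃[ k ] k ≢ i × k ≢ j × (∀ l → l ≡ i ⊎ l ≡ j ⊎ l ≡ k)
  thirdIndex 0F 0F i≢j = contradiction refl i≢j
  thirdIndex 0F 1F _ = 2F , (λ ()) , (λ ()) , λ { 0F → inj₁ refl ; 1F → inj₂ (inj₁ refl) ; 2F → inj₂ (inj₂ refl) }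
  thirdIndex 0F 2F _ = 1F , (λ ()) , (λ ()) , λ { 0F → inj₁ refl ; 2F → inj₂ (inj₁ refl) ; 1F → inj₂ (inj₂ refl) }
  thirdIndex 1F 0F _ = 2F , (λ ()) , (λ ()) , λ { 1F → inj₁ refl ; 0F → inj₂ (inj₁ refl) ; 2F → inj₂ (inj₂ refl) }
  thirdIndex 1F 1F i≢j = contradiction refl i≢j
  thirdIndex 1F 2F _ = 0F , (λ ()) , (λ ()) , λ { 1F → inj₁ refl ; 2F → inj₂ (inj₁ refl) ; 0F → inj₂ (inj₂ refl) }
  thirdIndex 2F 0F _ = 1F , (λ ()) , (λ ()) , λ { 2F → inj₁ refl ; 0F → inj₂ (inj₁ refl) ; 1F → inj₂ (inj₂ refl) }
  thirdIndex 2F 1F _ = 0F , (λ ()) , (λ ()) , λ { 2F → inj₁ refl ; 1F → inj₂ (inj₁ refl) ; 0F → inj₂ (inj₂ refl) }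
  thirdIndex 2F 2F i≢j = contradiction refl i≢j

  third : ∀ v (d₁ d₂ : Dart G) → tail G d₁ ≡ v → tail G d₂ ≡ v → d₁ ≢ d₂ → Third v d₁ d₂
  third v d₁ d₂ p₁ p₂ d₁≢d₂
    with k , k≢i , k≢j , cov ← thirdIndex (index d₁ p₁) (index d₂ p₂)
                                 (λ eq → d₁≢d₂ (index-injective p₁ p₂ eq)) = record
    { d₃ = dart v k
    ; at₃ = tail-dart v k
    ; ≢₁ = λ eq → k≢i (dart-injective (trans eq (sym (dart-index d₁ p₁))))
    ; ≢₂ = λ eq → k≢j (dart-injective (trans eq (sym (dart-index d₂ p₂))))
    ; three = λ d p → case cov (index d p) of λ
        { (inj₁ eq) → inj₁ (index-injective p p₁ eq)
        ; (inj₂ (inj₁ eq)) → inj₂ (inj₁ (index-injective p p₂ eq))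
        ; (inj₂ (inj₂ eq)) → inj₂ (inj₂ (trans (sym (dart-index d p)) (cong (dart v) eq))) }
    }

-- Edge cuts

-- Minimum degree two inside `vs`, which forces a cycle there. Darts are counted instead of
-- neighbours, so that loops and parallel edges qualify.
TwoBranched : (G : Graph) → List (V G) → Set
TwoBranched G vs = ∀ u → u ∈ vs → ∃₂ λ d₁ d₂ → d₁ ≢ d₂ ×
  (tail G d₁ ≡ u × head G d₁ ∈ vs) × (tail G d₂ ≡ u × head G d₂ ∈ vs)

module _ {G : Graph} (fc : FiniteCubic G) where
  open FiniteCubic fc
  open DecMembership _≟ᴱ_ using (_∈?_)

  -- Edges of `S` with both ends outside `vs` are allowed on purpose: pruning creates them whenever
  -- the third edge of a removed vertex leads out of `vs`.
  record Separates (S : List (E G)) (vs : List (V G)) : Set where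
    field
      leaves : ∀ d → tail G d ∈ vs → head G d ∈ vs ⊎ proj₁ d ∈ S
      outer  : ∀ e → e ∈ S → ∃[ s ] ends G e s ∉ vs

    not-inside : ∀ d → proj₁ d ∈ S → tail G d ∈ vs → head G d ∉ vs
    not-inside (e , s) e∈S t h with outer e e∈S
    not-inside (e , false) e∈S t h | false , x∉ = x∉ t
    not-inside (e , false) e∈S t h | true  , x∉ = x∉ h
    not-inside (e , true)  e∈S t h | true  , x∉ = x∉ t
    not-inside (e , true)  e∈S t h | false , x∉ = x∉ h

  open Separates

  -- A vertex of `vs` with this property keeps at most one dart into `vs`, so no cycle inside `vs`
  -- is lost with it.
  Leaf : List (E G) → V G → Set
  Leaf S v = ∃₂ λ i j → i ≢ j × proj₁ (dart v i) ∈ S × proj₁ (dart v j) ∈ S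

  leaf? : ∀ S v → Dec (Leaf S v)
  leaf? S v = Fin.any? λ i → Fin.any? λ j →
    ¬? (i Fin.≟ j) ×-dec (proj₁ (dart v i) ∈? S) ×-dec (proj₁ (dart v j) ∈? S)

  branched : ∀ {S vs} → Separates S vs → (∀ {v} → v ∈ vs → ¬ Leaf S v) → TwoBranched G vs
  branched {S} {vs} sep noleaf u u∈ = choose (in? 0F) (in? 1F) (in? 2F)
    where
    in? : ∀ i → Dec (proj₁ (dart u i) ∈ S)
    in? i = proj₁ (dart u i) ∈? S
    inside : ∀ i → proj₁ (dart u i) ∉ S → tail G (dart u i) ≡ u × head G (dart u i) ∈ vs
    inside i ∉S with leaves sep (dart u i) (subst (_∈ vs) (sym (tail-dart u i)) u∈)
    ... | inj₁ h = tail-dart u i , h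
    ... | inj₂ e = contradiction e ∉S
    Two : Set
    Two = ∃₂ λ d₁ d₂ → d₁ ≢ d₂ ×
      (tail G d₁ ≡ u × head G d₁ ∈ vs) × (tail G d₂ ≡ u × head G d₂ ∈ vs)
    two : ∀ i j → i ≢ j → proj₁ (dart u i) ∉ S → proj₁ (dart u j) ∉ S → Two
    two i j i≢j p q = dart u i , dart u j , (i≢j ∘ dart-injective) , inside i p , inside j q
    choose : Dec (proj₁ (dart u 0F) ∈ S) → Dec (proj₁ (dart u 1F) ∈ S) →
             Dec (proj₁ (dart u 2F) ∈ S) → Two
    choose (yes p) (yes q) _ = contradiction (0F , 1F , (λ ()) , p , q) (noleaf u∈)
    choose (yes p) _ (yes q) = contradiction (0F , 2F , (λ ()) , p , q) (noleaf u∈)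
    choose _ (yes p) (yes q) = contradiction (1F , 2F , (λ ()) , p , q) (noleaf u∈)
    choose (no p) (no q) _ = two 0F 1F (λ ()) p q
    choose (no p) _ (no q) = two 0F 2F (λ ()) p q
    choose _ (no p) (no q) = two 1F 2F (λ ()) p q

  Core : List (V G) → Set
  Core vs = ∃[ ws ] ws ⊆ vs × (∃[ w ] w ∈ ws) × TwoBranched G ws

  -- Vertices with two edges in S are removed one after the other.
  core-or-bound : ∀ n {S vs} → length vs ≡ n → Unique vs → Separates S vs →
                  Core vs ⊎ vs ≡ [] ⊎ 2 + length vs ≤ length S
  core-or-bound _ {vs = []} _ _ _ = inj₂ (inj₁ refl)
  core-or-bound zero {vs = _ ∷ _} ()
  core-or-bound (suc n) {S} {vs@(u ∷ _)} len uniq sep with any? (leaf? S) vs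
  ... | no noleaf = inj₁ (vs , id , (u , here refl) ,
                          branched sep λ v∈ leaf → noleaf (lose v∈ leaf))
  ... | yes someleaf with v , v∈ , i , j , i≢j , e₁∈ , e₂∈ ← find someleaf
    = prune
    where
    d₁ d₂ : Dart G
    d₁ = dart v i
    d₂ = dart v j

    t₁ : tail G d₁ ≡ v
    t₁ = tail-dart v i
    t₂ : tail G d₂ ≡ v
    t₂ = tail-dart v j

    open Third (third v d₁ d₂ t₁ t₂ (i≢j ∘ dart-injective))

    at-v : ∀ {d} → tail G d ≡ v → tail G d ∈ vs
    at-v t = subst (_∈ vs) (sym t) v∈

    distinct : ∀ {d d′} → tail G d ≡ v → tail G d′ ≡ v → proj₁ d ∈ S → d′ ≢ d → proj₁ d ≢ proj₁ d′
    distinct {d} {d′} t t′ d∈ d≢ eq with same-edge G d d′ eq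
    ... | inj₁ p = d≢ p
    ... | inj₂ refl = not-inside sep d d∈ (at-v t) (at-v t′)

    e₁≢e₂ : proj₁ d₁ ≢ proj₁ d₂
    e₁≢e₂ = distinct t₁ t₂ e₁∈ (i≢j ∘ sym ∘ dart-injective)

    vs′ : List (V G)
    vs′ = proj₁ (extract v∈)
    vs↭ : vs ↭ v ∷ vs′
    vs↭ = proj₂ (extract v∈)
    v∷vs′-unique : Unique (v ∷ vs′)
    v∷vs′-unique = Unique-↭ vs↭ uniq
    v∉ : v ∉ vs′
    v∉ = Unique-∉ v∷vs′-unique
    vs′⊆ : vs′ ⊆ vs
    vs′⊆ p = ∈-resp-↭ (↭-sym vs↭) (there p)
    lenvs : length vs ≡ suc (length vs′)
    lenvs = ↭-length vs↭

    ≢-∈ : ∀ {x y} {xs : List (E G)} → x ∈ y ∷ xs → x ≢ y → x ∈ xs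
    ≢-∈ (here p) q = contradiction p q
    ≢-∈ (there p) _ = p

    S₁ : List (E G)
    S₁ = proj₁ (extract e₁∈)
    S↭₁ : S ↭ proj₁ d₁ ∷ S₁
    S↭₁ = proj₂ (extract e₁∈)
    e₂∈₁ : proj₁ d₂ ∈ S₁
    e₂∈₁ = ≢-∈ (∈-resp-↭ S↭₁ e₂∈) (e₁≢e₂ ∘ sym)
    S₂ : List (E G)
    S₂ = proj₁ (extract e₂∈₁)
    S↭ : S ↭ proj₁ d₁ ∷ proj₁ d₂ ∷ S₂
    S↭ = ↭-trans S↭₁ (prep _ (proj₂ (extract e₂∈₁)))
    lenS : length S ≡ 2 + length S₂
    lenS = ↭-length S↭

    -- Two edges of `S` are exchanged for one while one vertex goes: both lengths drop by one, so
    -- the bound for `vs′` yields that for `vs`.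
    S′ : List (E G)
    S′ = proj₁ d₃ ∷ S₂

    sep′ : Separates S′ vs′
    sep′ = record { leaves = leaves′ ; outer = outer′ }
      where
      kept : ∀ d → tail G d ∈ vs′ → proj₁ d ∈ S → proj₁ d ∈ S₂
      back : ∀ d → tail G d ∈ vs′ → head G d ≡ v → proj₁ d ∈ S → ⊥
      back d t h d∈ = not-inside sep d d∈ (vs′⊆ t) (at-v {opposite G d} h)
      not-at : ∀ d d° → tail G d ∈ vs′ → tail G d° ≡ v → proj₁ d° ∈ S → proj₁ d ≢ proj₁ d°
      not-at d d° t t° d°∈ eq with same-edge G d° d (sym eq)
      ... | inj₁ refl = v∉ (subst (_∈ vs′) t° t)
      ... | inj₂ refl = back d t (trans (cong (tail G) (opposite² G d°)) t°) d°∈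
      kept d t d∈ = ≢-∈ (≢-∈ (∈-resp-↭ S↭ d∈) (not-at d d₁ t t₁ e₁∈)) (not-at d d₂ t t₂ e₂∈)
      leaves′ : ∀ d → tail G d ∈ vs′ → head G d ∈ vs′ ⊎ proj₁ d ∈ S′
      leaves′ d t with leaves sep d (vs′⊆ t)
      ... | inj₂ d∈ = inj₂ (there (kept d t d∈))
      ... | inj₁ h with ∈-resp-↭ vs↭ h
      ...   | there h′ = inj₁ h′
      ...   | here h≡ with three (opposite G d) h≡
      ...     | inj₁ eq = ⊥-elim (back d t h≡ (subst (_∈ S) (sym (cong proj₁ eq)) e₁∈))
      ...     | inj₂ (inj₁ eq) = ⊥-elim (back d t h≡ (subst (_∈ S) (sym (cong proj₁ eq)) e₂∈))
      ...     | inj₂ (inj₂ eq) = inj₂ (here (cong proj₁ eq))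
      outer′ : ∀ e → e ∈ S′ → ∃[ s ] ends G e s ∉ vs′
      outer′ e (here refl) = proj₂ d₃ , λ p → v∉ (subst (_∈ vs′) at₃ p)
      outer′ e (there e∈) with s , ∉vs ← outer sep e (∈-resp-↭ (↭-sym S↭) (there (there e∈))) =
        s , ∉vs ∘ vs′⊆

    -- Base of the count: the last vertex carries no loop, so its third edge lies in `S` too, and
    -- one vertex accounts for three edges.
    single : vs′ ≡ [] → 2 + length vs ≤ length S
    single vs′≡[] = subst (λ k → 2 + k ≤ length S) (sym (trans lenvs (cong (suc ∘ length) vs′≡[])))
                      (subst (3 ≤_) (sym lenS) (s≤s (s≤s (nonempty d₃∈S₂))))
      where
      nonempty : ∀ {x} {xs : List (E G)} → x ∈ xs → 1 ≤ length xs
      nonempty (here _) = s≤s z≤n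
      nonempty (there _) = s≤s z≤n
      noloop : head G d₃ ≢ v
      noloop h with three (opposite G d₃) h
      ... | inj₁ eq = distinct t₁ at₃ e₁∈ ≢₁ (sym (cong proj₁ eq))
      ... | inj₂ (inj₁ eq) = distinct t₂ at₃ e₂∈ ≢₂ (sym (cong proj₁ eq))
      ... | inj₂ (inj₂ eq) = opposite≢ G d₃ eq
      d₃∈S : proj₁ d₃ ∈ S
      d₃∈S with leaves sep d₃ (at-v at₃)
      ... | inj₂ p = p
      ... | inj₁ h with ∈-resp-↭ vs↭ h
      ...   | here p = contradiction p noloop
      ...   | there p rewrite vs′≡[] = case p of λ ()
      d₃∈S₂ : proj₁ d₃ ∈ S₂
      d₃∈S₂ = ≢-∈ (≢-∈ (∈-resp-↭ S↭ d₃∈S) (distinct t₁ at₃ e₁∈ ≢₁ ∘ sym))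
                  (distinct t₂ at₃ e₂∈ ≢₂ ∘ sym)

    prune : Core vs ⊎ vs ≡ [] ⊎ 2 + length vs ≤ length S
    prune with core-or-bound n (ℕ.suc-injective (trans (sym lenvs) len)) (Unique-tail v∷vs′-unique) sep′
    ... | inj₁ (ws , ws⊆ , ne , tb) = inj₁ (ws , vs′⊆ ∘ ws⊆ , ne , tb)
    ... | inj₂ (inj₁ vs′≡[]) = inj₂ (inj₂ (single vs′≡[]))
    ... | inj₂ (inj₂ bound) = inj₂ (inj₂ (ℕ.≤-trans (ℕ.≤-reflexive (cong (2 +_) lenvs))
                                (ℕ.≤-trans (s≤s bound) (ℕ.≤-reflexive (sym lenS)))))

-- Cycles

-- Unlike `walkVertices` this includes the final vertex, so that its being free of repetitions
-- characterises paths.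
verts : ∀ {G u v} → Walk G u v → List (V G)
verts {v = v} [] = v ∷ []
verts {G} (d ∷ w) = tail G d ∷ verts w

module _ {K : Graph} where

  start∈ : ∀ {u v} (w : Walk K u v) → u ∈ verts w
  start∈ [] = here refl
  start∈ (d ∷ w) = here refl

  record Prefix {u v} (w : Walk K u v) (x : V K) : Set where
    field
      walk    : Walk K u x
      edges⊆  : walkEdges walk ⊆ walkEdges w
      verts⊆  : walkVertices walk ⊆ verts w
      edges!  : Unique (walkEdges walk)
      verts!  : Unique (x ∷ walkVertices walk)

  prefix : ∀ {u v} (w : Walk K u v) → Unique (walkEdges w) → Unique (verts w) →
           DecidableEquality (V K) → ∀ {x} → x ∈ verts w → Prefix w x
  prefix [] ue uv _≟_ (here refl) = record
    { walk = [] ; edges⊆ = id ; verts⊆ = λ () ; edges! = [] ; verts! = [] ∷ [] }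
  prefix (d ∷ w) ue uv _≟_ {x} x∈ with x ≟ tail K d
  ... | yes refl = record { walk = [] ; edges⊆ = λ () ; verts⊆ = λ () ; edges! = [] ; verts! = [] ∷ [] }
  prefix (d ∷ w) ue uv _≟_ {x} (here eq) | no x≢ = contradiction eq x≢
  prefix (d ∷ w) ue uv _≟_ {x} (there x∈) | no x≢ = record
    { walk = d ∷ walk
    ; edges⊆ = λ { (here p) → here p ; (there p) → there (edges⊆ p) }
    ; verts⊆ = λ { (here p) → here p ; (there p) → there (verts⊆ p) }
    ; edges! = ∉-Unique (Unique-∉ ue ∘ edges⊆) edges!
    ; verts! = ∉-Unique (λ { (here p) → x≢ p ; (there p) → Unique-∉ verts! p })
                        (∉-Unique (Unique-∉ uv ∘ verts⊆) (Unique-tail verts!))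
    }
    where open Prefix (prefix w (Unique-tail ue) (Unique-tail uv) _≟_ x∈)

  walkEdge-head : ∀ {u v} (w : Walk K u v) (d : Dart K) → proj₁ d ∈ walkEdges w → head K d ∈ verts w
  walkEdge-head (δ ∷ w) d (here eq) with same-edge K d δ eq
  ... | inj₁ refl = there (start∈ w)
  ... | inj₂ refl = here refl
  walkEdge-head (δ ∷ w) d (there p) = there (walkEdge-head w d p)

  -- A path does not return to its start, so `δ` is the only dart there that `extend` has to avoid;
  -- one of two branching darts does.
  first-edge : ∀ {v} (δ : Dart K) (w : Walk K (head K δ) v) → Unique (verts (δ ∷ w)) →
               ∀ d → head K d ≡ tail K δ → proj₁ d ∈ walkEdges (δ ∷ w) → d ≡ opposite K δ
  first-edge δ w uv d h (there p) = contradiction (subst (_∈ verts w) h (walkEdge-head w d p)) (Unique-∉ uv)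
  first-edge δ w uv d h (here eq) with same-edge K δ d (sym eq)
  ... | inj₁ refl = contradiction (subst (_∈ verts w) h (start∈ w)) (Unique-∉ uv)
  ... | inj₂ p = p

  module _ (_≟ⱽ_ : DecidableEquality (V K)) (_≟ᴰ_ : DecidableEquality (Dart K))
           (core : List (V K)) (branch : TwoBranched K core) where

    record Extension {u v} (w : Walk K u v) : Set where
      field
        d     : Dart K
        head≡ : head K d ≡ u
        tail∈ : tail K d ∈ core
        fresh : proj₁ d ∉ walkEdges w

    extend : ∀ {u v} (w : Walk K u v) → Unique (verts w) → u ∈ core → Extension w
    extend {u} [] uv u∈ with d₁ , _ , _ , (t₁ , h₁) , _ ← branch u u∈ = record
      { d = opposite K d₁ ; head≡ = trans (cong (tail K) (opposite² K d₁)) t₁ ; tail∈ = h₁ ; fresh = λ () }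
    extend {u} (δ ∷ w) uv u∈ with branch u u∈
    ... | d₁ , d₂ , d₁≢d₂ , (t₁ , h₁) , (t₂ , h₂) = choose (d₁ ≟ᴰ δ)
      where
      ext : ∀ d → tail K d ≡ u → head K d ∈ core → d ≢ δ → Extension (δ ∷ w)
      ext d t h d≢δ = record
        { d = opposite K d ; head≡ = t′ ; tail∈ = h
        ; fresh = λ p → d≢δ (trans (sym (opposite² K d))
            (trans (cong (opposite K) (first-edge δ w uv (opposite K d) t′ p)) (opposite² K δ))) }
        where
        t′ : head K (opposite K d) ≡ u
        t′ = trans (cong (tail K) (opposite² K d)) t
      choose : Dec (d₁ ≡ δ) → Extension (δ ∷ w)
      choose (yes refl) = ext d₂ t₂ h₂ (d₁≢d₂ ∘ sym)
      choose (no d₁≢δ) = ext d₁ t₁ h₁ d₁≢δ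

    open DecMembership _≟ⱽ_ using (_∈?_)

    -- The path is prolonged at its start. If the new vertex is already on it, the new dart and the
    -- prefix up to that vertex form a cycle. The fuel `n` cannot run out, since the path would then
    -- have more vertices than `core`.
    grow : ∀ n {u v} (w : Walk K u v) → length core < n + length (verts w) →
           Unique (walkEdges w) → Unique (verts w) → verts w ⊆ core →
           ∃[ x ] x ∈ core × CycleAt K x
    grow zero w len ue uv sub = contradiction (ℕ.≤-trans len (Unique-⊆-length uv sub)) (ℕ.<-irrefl refl)
    grow (suc n) {u} w len ue uv sub with extend w uv (sub (start∈ w))
    ... | record { d = d ; head≡ = refl ; tail∈ = tail∈ ; fresh = fresh } with tail K d ∈? verts w
    ...   | yes x∈ = tail K d , tail∈ , record
      { walk = d ∷ walk
      ; nonempty = λ ()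
      ; unique-edges = ∉-Unique (fresh ∘ edges⊆) edges!
      ; unique-vertices = verts!
      }
      where open Prefix (prefix w ue uv _≟ⱽ_ x∈)
    ...   | no x∉ = grow n (d ∷ w) (subst (length core <_) (sym (ℕ.+-suc n _)) len)
                      (∉-Unique fresh ue) (∉-Unique x∉ uv)
                      (λ { (here refl) → tail∈ ; (there p) → sub p })

    core-cycle : ∀ {u} → u ∈ core → ∃[ x ] x ∈ core × CycleAt K x
    core-cycle {u} u∈ = grow (suc (length core)) {u} [] (ℕ.m≤m+n (suc (length core)) 1) [] ([] ∷ [])
                          (λ { (here refl) → u∈ })

module _ {G : Graph} (fc : FiniteCubic G) {S : List (E G)} where
  open FiniteCubic fc
  open DecMembership _≟ᴱ_ using (_∈?_)

  private
    K : Graph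
    K = delete G (_∈ S)

  survivor : ∀ (d : Dart G) → proj₁ d ∉ S → Dart K
  survivor (e , s) e∉ = (e , [ e∉ ]) , s

  not-deleted : ∀ (d : Dart K) → value (proj₁ d) ∉ S
  not-deleted ((e , [ e∉ ]) , s) e∈ = ⊥-elim-irr (e∉ e∈)

  delete-≟ᴰ : DecidableEquality (Dart K)
  delete-≟ᴰ = Product.≡-dec
    (λ x y → map′ (λ { refl → refl }) (cong value) (value x ≟ᴱ value y)) Bool._≟_

  core-delete : ∀ {vs ws} → Separates fc S vs → ws ⊆ vs → TwoBranched G ws → TwoBranched K ws
  core-delete {ws = ws} sep ws⊆ branch u u∈ with branch u u∈
  ... | d₁ , d₂ , d₁≢d₂ , (refl , h₁) , (t₂ , h₂) =
    survivor d₁ (out d₁ u∈ h₁) , survivor d₂ (out d₂ (subst (_∈ ws) (sym t₂) u∈) h₂) ,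
    (λ { refl → d₁≢d₂ refl }) , (refl , h₁) , (t₂ , h₂)
    where
    out : ∀ d → tail G d ∈ ws → head G d ∈ ws → proj₁ d ∉ S
    out d t h d∈ = Separates.not-inside sep d d∈ (ws⊆ t) (ws⊆ h)

  -- If pruning stopped at a core, the core would contain a cycle, and `S` would separate it from
  -- the cycle at `u`, because walks avoiding `S` never enter `vs`. So pruning removes every vertex.
  cut-bound : ∀ {k} → CyclicallyEdgeConnected k G → length S < k →
              ∀ {vs} → Unique vs → Separates fc S vs →
              ∀ {u} → u ∉ vs → CycleAt K u → vs ≡ [] ⊎ 2 + length vs ≤ length S
  cut-bound (_ , cyc) len {vs} uniq sep {u} u∉ cycle with core-or-bound fc _ refl uniq sep
  ... | inj₂ r = r
  ... | inj₁ (ws , ws⊆ , (_ , w∈) , branch)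
    with x , x∈ , cycle′ ← core-cycle _≟ⱽ_ delete-≟ᴰ ws (core-delete sep ws⊆ branch) w∈ =
    contradiction (u , x , cycle , cycle′ , λ w → stays w u∉ (ws⊆ x∈)) (cyc S len)
    where
    stays : ∀ {u x} → Walk K u x → u ∉ vs → x ∉ vs
    stays [] u∉ = u∉
    stays (d ∷ w) u∉ = stays w λ h → escape h
      where
      escape : head K d ∉ vs
      escape h with Separates.leaves sep (opposite G (value (proj₁ d) , proj₂ d)) h
      ... | inj₁ t = u∉ (subst (_∈ vs) (cong (tail G) (opposite² G (value (proj₁ d) , proj₂ d))) t)
      ... | inj₂ e∈ = not-deleted d e∈

  loop-cycle : ∀ (d : Dart G) → head G d ≡ tail G d → proj₁ d ∉ S → CycleAt K (tail G d)
  loop-cycle d h d∉ = record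
    { walk = proj₁ w
    ; nonempty = λ eq → case trans (sym (proj₁ (proj₂ w))) eq of λ ()
    ; unique-edges = subst Unique (sym (proj₁ (proj₂ w))) ([] ∷ [])
    ; unique-vertices = subst Unique (sym (proj₂ (proj₂ w))) ([] ∷ []) }
    where
    d° : Dart K
    d° = survivor d d∉
    close : ∀ {x} → head K d° ≡ x →
            ∃[ w ] walkEdges {K} {tail K d°} {x} w ≡ proj₁ d° ∷ [] × walkVertices w ≡ tail K d° ∷ []
    close refl = d° ∷ [] , refl , refl
    w : ∃[ w ] walkEdges {K} {tail K d°} {tail K d°} w ≡ proj₁ d° ∷ [] × walkVertices w ≡ tail K d° ∷ []
    w = close h

finiteCubic : ∀ {G} → Snark G → FiniteCubic G
finiteCubic s = record { finite = Snark.finite s ; cubic = Snark.cubic s }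

opposite-injective : ∀ (G : Graph) {d d′} → opposite G d ≡ opposite G d′ → d ≡ d′
opposite-injective G {d} {d′} eq =
  trans (sym (opposite² G d)) (trans (cong (opposite G) eq) (opposite² G d′))

-- Isomorphisms

infix 4 _≃_
-- Mapping darts instead of edges replaces the two alternatives of `ends-resp` by the single law
-- `opposite-toᴰ`. The inverses belong to the data, so that constructions can be carried in both
-- directions.
record _≃_ (G H : Graph) : Set where
  field
    to        : V G → V H
    from      : V H → V G
    from-to   : ∀ v → from (to v) ≡ v
    to-from   : ∀ v → to (from v) ≡ v
    toᴰ       : Dart G → Dart H
    fromᴰ     : Dart H → Dart G
    fromᴰ-toᴰ : ∀ d → fromᴰ (toᴰ d) ≡ d
    toᴰ-fromᴰ : ∀ d → toᴰ (fromᴰ d) ≡ d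
    tail-toᴰ  : ∀ d → tail H (toᴰ d) ≡ to (tail G d)
    opposite-toᴰ : ∀ d → toᴰ (opposite G d) ≡ opposite H (toᴰ d)

  to-injective : ∀ {u v} → to u ≡ to v → u ≡ v
  to-injective {u} {v} eq = trans (sym (from-to u)) (trans (cong from eq) (from-to v))

  toᴰ-injective : ∀ {u v} → toᴰ u ≡ toᴰ v → u ≡ v
  toᴰ-injective {u} {v} eq = trans (sym (fromᴰ-toᴰ u)) (trans (cong fromᴰ eq) (fromᴰ-toᴰ v))

  toᴰ-edge : ∀ d d′ → proj₁ d ≡ proj₁ d′ → proj₁ (toᴰ d) ≡ proj₁ (toᴰ d′)
  toᴰ-edge d d′ eq with same-edge G d d′ eq
  ... | inj₁ refl = refl
  ... | inj₂ refl = sym (cong proj₁ (opposite-toᴰ d))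

≃-sym : ∀ {G H} → G ≃ H → H ≃ G
≃-sym {G} {H} φ = record
  { to = from φ ; from = to φ ; from-to = to-from φ ; to-from = from-to φ
  ; toᴰ = fromᴰ φ ; fromᴰ = toᴰ φ ; fromᴰ-toᴰ = toᴰ-fromᴰ φ ; toᴰ-fromᴰ = fromᴰ-toᴰ φ
  ; tail-toᴰ = λ d → to-injective φ (trans (sym (tail-toᴰ φ (fromᴰ φ d)))
      (trans (cong (tail H) (toᴰ-fromᴰ φ d)) (sym (to-from φ _))))
  ; opposite-toᴰ = λ d → toᴰ-injective φ (trans (toᴰ-fromᴰ φ _)
      (trans (cong (opposite H) (sym (toᴰ-fromᴰ φ d))) (sym (opposite-toᴰ φ _))))
  }
  where open _≃_

≃-trans : ∀ {G H K} → G ≃ H → H ≃ K → G ≃ K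
≃-trans φ ψ = record
  { to = to ψ ∘ to φ ; from = from φ ∘ from ψ
  ; from-to = λ v → trans (cong (from φ) (from-to ψ _)) (from-to φ v)
  ; to-from = λ v → trans (cong (to ψ) (to-from φ _)) (to-from ψ v)
  ; toᴰ = toᴰ ψ ∘ toᴰ φ ; fromᴰ = fromᴰ φ ∘ fromᴰ ψ
  ; fromᴰ-toᴰ = λ v → trans (cong (fromᴰ φ) (fromᴰ-toᴰ ψ _)) (fromᴰ-toᴰ φ v)
  ; toᴰ-fromᴰ = λ v → trans (cong (toᴰ ψ) (toᴰ-fromᴰ φ _)) (toᴰ-fromᴰ ψ v)
  ; tail-toᴰ = λ d → trans (tail-toᴰ ψ _) (cong (to ψ) (tail-toᴰ φ d))
  ; opposite-toᴰ = λ d → trans (cong (toᴰ ψ) (opposite-toᴰ φ d)) (opposite-toᴰ ψ _)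
  }
  where open _≃_

≅⇒≃ : ∀ {G H} → G ≅ H → G ≃ H
≅⇒≃ {G} {H} i = record
  { to = f ; from = f⁻¹
  ; from-to = λ v → proj₁ (_≅_.onV-bijective i) (f-f⁻¹ (f v)) ; to-from = f-f⁻¹
  ; toᴰ = toD ; fromᴰ = fromD
  ; fromᴰ-toᴰ = λ d → toD-injective (toD-fromD (toD d)) ; toᴰ-fromᴰ = toD-fromD
  ; tail-toᴰ = tail-toD
  ; opposite-toᴰ = λ (e , s) → cong (onE h e ,_) (twist-not (ends-resp h e) s)
  }
  where
  h : Hom G H
  h = _≅_.iso i
  f : V G → V H
  f = onV h
  f⁻¹ : V H → V G
  f⁻¹ v = proj₁ (proj₂ (_≅_.onV-bijective i) v)
  f-f⁻¹ : ∀ v → f (f⁻¹ v) ≡ v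
  f-f⁻¹ v = proj₂ (proj₂ (_≅_.onV-bijective i) v) refl
  g⁻¹ : E H → E G
  g⁻¹ e = proj₁ (proj₂ (_≅_.onE-bijective i) e)
  g-g⁻¹ : ∀ e → onE h (g⁻¹ e) ≡ e
  g-g⁻¹ e = proj₂ (proj₂ (_≅_.onE-bijective i) e) refl
  twist : {A B : Set} → A ⊎ B → Bool → Bool
  twist (inj₁ _) s = s
  twist (inj₂ _) s = not s
  twist² : {A B : Set} (x : A ⊎ B) (s : Bool) → twist x (twist x s) ≡ s
  twist² (inj₁ _) s = refl
  twist² (inj₂ _) s = Bool.not-involutive s
  twist-not : {A B : Set} (x : A ⊎ B) (s : Bool) → twist x (not s) ≡ not (twist x s)
  twist-not (inj₁ _) s = refl
  twist-not (inj₂ _) s = refl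
  toD : Dart G → Dart H
  toD (e , s) = onE h e , twist (ends-resp h e) s
  fromD : Dart H → Dart G
  fromD (e , s) = g⁻¹ e , twist (ends-resp h (g⁻¹ e)) s
  toD-fromD : ∀ d → toD (fromD d) ≡ d
  toD-fromD (e , s) = cong₂ _,_ (g-g⁻¹ e) (twist² (ends-resp h (g⁻¹ e)) s)
  toD-injective : ∀ {d d′} → toD d ≡ toD d′ → d ≡ d′
  toD-injective {e , s} {e′ , s′} eq with refl ← proj₁ (_≅_.onE-bijective i) (cong proj₁ eq) =
    cong (e ,_) (trans (sym (twist² (ends-resp h e) s))
      (trans (cong (twist (ends-resp h e) ∘ proj₂) eq) (twist² (ends-resp h e) s′)))
  tail-toD : ∀ d → tail H (toD d) ≡ f (tail G d)
  tail-toD (e , s) with ends-resp h e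
  ... | inj₁ p = p s
  ... | inj₂ p = trans (p (not s)) (cong (f ∘ ends G e) (Bool.not-involutive s))

≃⇒≅ : ∀ {G H} → G ≃ H → G ≅ H
≃⇒≅ {G} {H} φ = record
  { iso = record { onV = to φ ; onE = g ; ends-resp = resp }
  ; onV-bijective = to-injective φ , λ v → from φ v , λ { refl → to-from φ v }
  ; onE-bijective = inj , λ e → proj₁ (fromᴰ φ (e , false)) ,
      λ { refl → trans (toᴰ-edge φ (_ , false) (fromᴰ φ (e , false)) refl) (cong proj₁ (toᴰ-fromᴰ φ _)) }
  }
  where
  open _≃_
  g : E G → E H
  g e = proj₁ (toᴰ φ (e , false))
  inj : ∀ {e e′} → g e ≡ g e′ → e ≡ e′
  inj {e} {e′} eq with same-edge H (toᴰ φ (e , false)) (toᴰ φ (e′ , false)) eq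
  ... | inj₁ p = sym (cong proj₁ (toᴰ-injective φ p))
  ... | inj₂ p = sym (cong proj₁ (toᴰ-injective φ (trans p (sym (opposite-toᴰ φ (e , false))))))
  ends-at : ∀ e t → tail H (opposite H (toᴰ φ (e , t))) ≡ to φ (ends G e (not t))
  ends-at e t = trans (cong (tail H) (sym (opposite-toᴰ φ (e , t)))) (tail-toᴰ φ (e , not t))
  resp : ∀ e → (∀ s → ends H (g e) s ≡ to φ (ends G e s)) ⊎
               (∀ s → ends H (g e) s ≡ to φ (ends G e (not s)))
  resp e with toᴰ φ (e , false) in eq | tail-toᴰ φ (e , false) | ends-at e false
  ... | e′ , false | p | q = inj₁ λ { false → p ; true → q }
  ... | e′ , true  | p | q = inj₂ λ { false → q ; true → p }

-- Graphs with at most two vertices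

AtMostTwo : Set → Set
AtMostTwo A = ∀ (u v w : A) → u ≡ v ⊎ u ≡ w ⊎ v ≡ w

module _ (G : 𝓕₅) where
  private
    Γ : Graph
    Γ = 𝓕₅.graph G
    fc : FiniteCubic Γ
    fc = finiteCubic (𝓕₅.snark G)
    cyc : CyclicallyEdgeConnected 4 Γ
    cyc = Snark.cyclically-4-edge-connected (𝓕₅.snark G)
  open FiniteCubic fc

  private
    -- Beside a loop only one dart is left at `x`. It cannot return to `x`, so its edge is a bridge
    -- that separates `y` from the loop, and the count would give 3 ≤ 1.
    no-loop : ∀ x y → (∀ v → v ≡ x ⊎ v ≡ y) → ∀ d → tail Γ d ≡ x → head Γ d ≢ x
    no-loop x y only d t h = impossible (only (head Γ d₃))
      where
      open Third (third x d (opposite Γ d) t h (opposite≢ Γ d ∘ sym))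
      stays : head Γ d₃ ≢ x
      stays h₃ with three (opposite Γ d₃) h₃
      ... | inj₁ eq = ≢₂ (trans (sym (opposite² Γ d₃)) (cong (opposite Γ) eq))
      ... | inj₂ (inj₁ eq) = ≢₁ (opposite-injective Γ eq)
      ... | inj₂ (inj₂ eq) = opposite≢ Γ d₃ eq
      bridge : ∀ {d′} → tail Γ d′ ≡ y → head Γ d′ ≡ x → y ≢ x → d′ ≡ opposite Γ d₃
      bridge {d′} t′ h′ y≢x with three (opposite Γ d′) h′
      ... | inj₁ eq = contradiction (trans (sym t′) (trans (cong (tail Γ)
              (trans (sym (opposite² Γ d′)) (cong (opposite Γ) eq))) h)) y≢x
      ... | inj₂ (inj₁ eq) = contradiction (trans (sym t′) (trans (cong (tail Γ) (opposite-injective Γ eq)) t)) y≢x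
      ... | inj₂ (inj₂ eq) = trans (sym (opposite² Γ d′)) (cong (opposite Γ) eq)
      impossible : head Γ d₃ ≡ x ⊎ head Γ d₃ ≡ y → ⊥
      impossible (inj₁ h₃) = stays h₃
      impossible (inj₂ h₃) with cut-bound fc {S = proj₁ d₃ ∷ []} cyc (s≤s (s≤s z≤n))
                               {y ∷ []} ([] ∷ []) sep {tail Γ d} x∉ (loop-cycle fc d (trans h (sym t)) d∉)
        where
        y≢x : y ≢ x
        y≢x y≡x = stays (trans h₃ y≡x)
        x∉ : tail Γ d ∉ y ∷ []
        x∉ (here eq) = y≢x (trans (sym eq) t)
        d∉ : proj₁ d ∉ proj₁ d₃ ∷ []
        d∉ (here eq) with same-edge Γ d d₃ eq
        ... | inj₁ p = ≢₁ p
        ... | inj₂ p = ≢₂ p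
        sep : Separates fc (proj₁ d₃ ∷ []) (y ∷ [])
        sep = record
          { leaves = leaves
          ; outer = λ { _ (here refl) → proj₂ d₃ , λ { (here eq) → y≢x (trans (sym eq) at₃) } } }
          where
          leaves : ∀ d → tail Γ d ∈ y ∷ [] → head Γ d ∈ y ∷ [] ⊎ proj₁ d ∈ proj₁ d₃ ∷ []
          leaves d (here t′) with only (head Γ d)
          ... | inj₁ h′ = inj₂ (here (cong proj₁ (bridge t′ h′ y≢x)))
          ... | inj₂ h′ = inj₁ (here h′)
      ... | inj₁ ()
      ... | inj₂ (s≤s ())

    -- Without loops every edge joins `x` to `y`, so the numbering of the three darts at `x` is a
    -- proper colouring.
    theta : ∀ x y → (∀ v → v ≡ x ⊎ v ≡ y) → ⊥
    theta x y only = Snark.not-3-edge-colorable (𝓕₅.snark G) (colour , proper)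
      where
      only′ : ∀ v → v ≡ y ⊎ v ≡ x
      only′ v = case only v of λ { (inj₁ p) → inj₂ p ; (inj₂ p) → inj₁ p }
      x→y : ∀ d → tail Γ d ≡ x → head Γ d ≡ y
      x→y d t with only (head Γ d)
      ... | inj₁ h = contradiction h (no-loop x y only d t)
      ... | inj₂ h = h
      y→x : ∀ d → tail Γ d ≡ y → head Γ d ≡ x
      y→x d t with only (head Γ d)
      ... | inj₁ h = h
      ... | inj₂ h = contradiction h (no-loop y x only′ d t)
      x≢y : x ≢ y
      x≢y refl = no-loop x x only (dart x 0F) (tail-dart x 0F) (x→y (dart x 0F) (tail-dart x 0F))
      at-x : ∀ e → ∃[ s ] ends Γ e s ≡ x
      at-x e with only (ends Γ e false)
      ... | inj₁ p = false , p
      ... | inj₂ p = true , y→x (e , false) p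
      colour : E Γ → Fin 3
      colour e = index (e , proj₁ (at-x e)) (proj₂ (at-x e))
      s-unique : ∀ e {s s′} → ends Γ e s ≡ x → ends Γ e s′ ≡ x → s ≡ s′
      s-unique e {false} {false} p q = refl
      s-unique e {true} {true} p q = refl
      s-unique e {false} {true} p q = contradiction (trans (sym q) (x→y (e , false) p)) x≢y
      s-unique e {true} {false} p q = contradiction (trans (sym p) (x→y (e , false) q)) x≢y
      proper : ∀ d d′ → d ≢ d′ → tail Γ d ≡ tail Γ d′ → colour (proj₁ d) ≢ colour (proj₁ d′)
      proper (e , s) (e′ , s′) d≢d′ t eq
        with refl ← cong proj₁ (index-injective (proj₂ (at-x e)) (proj₂ (at-x e′)) eq) | only (ends Γ e s)
      ... | inj₁ p = d≢d′ (cong (e ,_) (s-unique e p (trans (sym t) p)))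
      ... | inj₂ p = d≢d′ (cong (e ,_) (trans (sym (Bool.not-involutive s)) (trans
                       (cong not (s-unique e (y→x (e , s) p) (y→x (e , s′) (trans (sym t) p)))) (Bool.not-involutive s′))))

  ¬AtMostTwo : ¬ AtMostTwo (V Γ)
  -- The predicate `v ≡ v` merely asks for some vertex; a graph without vertices has no darts, and
  -- any colouring of it is proper.
  ¬AtMostTwo two with anyV? {λ v → v ≡ v} (λ v → yes refl)
  ... | no none = Snark.not-3-edge-colorable (𝓕₅.snark G)
          ((λ e → 0F) , λ d _ _ _ _ → none (tail Γ d , refl))
  ... | yes (x , _) with anyV? (λ v → ¬? (v ≟ⱽ x))
  ...   | no none = theta x x λ v → case v ≟ⱽ x of λ
            { (yes p) → inj₁ p ; (no p) → contradiction (v , p) none }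
  ...   | yes (y , y≢x) = theta x y λ v → case two x y v of λ
            { (inj₁ p) → contradiction (sym p) y≢x
            ; (inj₂ (inj₁ p)) → inj₁ (sym p)
            ; (inj₂ (inj₂ p)) → inj₂ (sym p) }

-- The Blanuša block

infix 4 _≟ᴴ_
_≟ᴴ_ : DecidableEquality HalfEdge
a  ≟ᴴ a  = yes refl
a  ≟ᴴ a′ = no λ ()
a  ≟ᴴ b  = no λ ()
a  ≟ᴴ b′ = no λ ()
a′ ≟ᴴ a  = no λ ()
a′ ≟ᴴ a′ = yes refl
a′ ≟ᴴ b  = no λ ()
a′ ≟ᴴ b′ = no λ ()
b  ≟ᴴ a  = no λ ()
b  ≟ᴴ a′ = no λ ()
b  ≟ᴴ b  = yes refl
b  ≟ᴴ b′ = no λ ()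
b′ ≟ᴴ a  = no λ ()
b′ ≟ᴴ a′ = no λ ()
b′ ≟ᴴ b  = no λ ()
b′ ≟ᴴ b′ = yes refl

halfEdges : List HalfEdge
halfEdges = a ∷ a′ ∷ b ∷ b′ ∷ []

∈-halfEdges : ∀ h → h ∈ halfEdges
∈-halfEdges a  = here refl
∈-halfEdges a′ = there (here refl)
∈-halfEdges b  = there (there (here refl))
∈-halfEdges b′ = there (there (there (here refl)))

all-half? : ∀ {P : HalfEdge → Set} → (∀ h → Dec (P h)) → Dec (∀ h → P h)
all-half? P? with P? a | P? a′ | P? b | P? b′
... | yes p | yes q | yes r | yes s = yes λ { a → p ; a′ → q ; b → r ; b′ → s }
... | no p | _ | _ | _ = no λ f → p (f a)
... | _ | no p | _ | _ = no λ f → p (f a′)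
... | _ | _ | no p | _ = no λ f → p (f b)
... | _ | _ | _ | no p = no λ f → p (f b′)

partner : HalfEdge → HalfEdge
partner a  = a′
partner a′ = a
partner b  = b′
partner b′ = b

isB : HalfEdge → Bool
isB a  = false
isB a′ = false
isB b  = true
isB b′ = true

isB-partner : ∀ h → isB h ≡ isB (partner h)
isB-partner a  = refl
isB-partner a′ = refl
isB-partner b  = refl
isB-partner b′ = refl

Differ : HalfEdge → HalfEdge → HalfEdge → Set
Differ h₁ h₂ h = h ≢ h₁ × h ≢ h₂

differ? : ∀ h₁ h₂ h → Dec (Differ h₁ h₂ h)
differ? h₁ h₂ h = ¬? (h ≟ᴴ h₁) ×-dec ¬? (h ≟ᴴ h₂)

others : HalfEdge → HalfEdge → List HalfEdge
others h₁ h₂ = filter (differ? h₁ h₂) halfEdges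

∈-others : ∀ {h₁ h₂ h} → h ≢ h₁ → h ≢ h₂ → h ∈ others h₁ h₂
∈-others {h₁} {h₂} {h} p q = ∈-filter⁺ (differ? h₁ h₂) (∈-halfEdges h) (p , q)

abstract
  length-others : ∀ h₁ h₂ → h₁ ≢ h₂ → length (others h₁ h₂) ≡ 2
  length-others = from-yes (all-half? λ h₁ → all-half? λ h₂ → dec h₁ h₂)
    where
    dec : ∀ h₁ h₂ → Dec (h₁ ≢ h₂ → length (others h₁ h₂) ≡ 2)
    dec h₁ h₂ with length (others h₁ h₂) ℕ.≟ 2 | h₁ ≟ᴴ h₂
    ... | yes p | _ = yes λ _ → p
    ... | no _  | yes p = yes λ q → contradiction p q
    ... | no p  | no q = no λ f → p (f q)

Adjacent : Fin 8 → Fin 8 → Set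
Adjacent i j = ∃[ d ] tail B₀ d ≡ i × head B₀ d ≡ j

adjacent? : ∀ i j → Dec (Adjacent i j)
adjacent? i j = map′
  (λ { (e , inj₁ p) → (e , false) , p ; (e , inj₂ p) → (e , true) , p })
  (λ { ((e , false) , p) → e , inj₁ p ; ((e , true) , p) → e , inj₂ p })
  (Fin.any? λ e → link? (e , false) ⊎-dec link? (e , true))
  where
  link? : ∀ d → Dec (tail B₀ d ≡ i × head B₀ d ≡ j)
  link? d = (tail B₀ d Fin.≟ i) ×-dec (head B₀ d Fin.≟ j)

Adjacent-sym : ∀ {i j} → Adjacent i j → Adjacent j i
Adjacent-sym (d , p , q) = opposite B₀ d , q , trans (cong (tail B₀) (opposite² B₀ d)) p

CommonNeighbour : HalfEdge → HalfEdge → Set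
CommonNeighbour h₁ h₂ = ∃[ i ] Adjacent (foot h₁) i × Adjacent i (foot h₂)

commonNeighbour? : ∀ h₁ h₂ → Dec (CommonNeighbour h₁ h₂)
commonNeighbour? h₁ h₂ = Fin.any? λ i → adjacent? (foot h₁) i ×-dec adjacent? i (foot h₂)

abstract
  -- No inner edge of a block joins two vertices that both carry a leg; this excludes the cut paths
  -- of `cutPattern`.
  feet-nonadjacent : ∀ h₁ h₂ → ¬ Adjacent (foot h₁) (foot h₂)
  feet-nonadjacent = from-yes (all-half? λ h₁ → all-half? λ h₂ → ¬? (adjacent? (foot h₁) (foot h₂)))

  partners-far : ∀ h → ¬ CommonNeighbour h (partner h)
  partners-far = from-yes (all-half? λ h → ¬? (commonNeighbour? h (partner h)))

  common-or-partner : ∀ h₁ h₂ → h₁ ≡ h₂ ⊎ h₂ ≡ partner h₁ ⊎ CommonNeighbour h₁ h₂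
  common-or-partner = from-yes (all-half? λ h₁ → all-half? λ h₂ →
    (h₁ ≟ᴴ h₂) ⊎-dec (h₂ ≟ᴴ partner h₁) ⊎-dec commonNeighbour? h₁ h₂)

foot-injective : ∀ {h₁ h₂} → foot h₁ ≡ foot h₂ → h₁ ≡ h₂
foot-injective {a} {a} eq = refl
foot-injective {a′} {a′} eq = refl
foot-injective {b} {b} eq = refl
foot-injective {b′} {b′} eq = refl

-- The cycle 0, 1, 6, 5, 3. It is the cycle on the block's own side of every cut in
-- `block-cut-bound`.
pentagon : Walk B₀ 0F 0F
pentagon = (0F , false) ∷ (7F , false) ∷ (3F , true) ∷ (6F , true) ∷ (5F , true) ∷ []

abstract
  pentagon-edges : Unique (walkEdges pentagon)
  pentagon-edges = from-yes (allPairs? (λ x y → ¬? (x Fin.≟ y)) (walkEdges pentagon))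

  pentagon-vertices : Unique (walkVertices pentagon)
  pentagon-vertices = from-yes (allPairs? (λ x y → ¬? (x Fin.≟ y)) (walkVertices pentagon))

-- Blocks in cubic graphs

-- Where the legs end is left undetermined: an edge of `H` at a block obtained by `descend` could
-- return to that block, and only a colouring argument, `β-open`, rules this out.
record Block (Γ : Graph) : Set where
  field
    at              : Fin 8 → V Γ
    inner           : Dart B₀ → Dart Γ
    leg             : HalfEdge → Dart Γ
    at-injective    : ∀ {i j} → at i ≡ at j → i ≡ j
    inner-injective : ∀ {d d′} → inner d ≡ inner d′ → d ≡ d′
    leg-injective   : ∀ {h h′} → leg h ≡ leg h′ → h ≡ h′
    inner≢leg       : ∀ {d h} → inner d ≢ leg h
    tail-inner      : ∀ d → tail Γ (inner d) ≡ at (tail B₀ d)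
    tail-leg        : ∀ h → tail Γ (leg h) ≡ at (foot h)
    opposite-inner  : ∀ d → inner (opposite B₀ d) ≡ opposite Γ (inner d)
    cover           : ∀ δ i → tail Γ δ ≡ at i → (∃[ d ] inner d ≡ δ) ⊎ (∃[ h ] leg h ≡ δ)

  head-inner : ∀ d → head Γ (inner d) ≡ at (head B₀ d)
  head-inner d = trans (cong (tail Γ) (sym (opposite-inner d))) (tail-inner (opposite B₀ d))

  inner-edge≢leg-edge : ∀ d h → proj₁ (inner d) ≢ proj₁ (leg h)
  inner-edge≢leg-edge d h eq with same-edge Γ (inner d) (leg h) eq
  ... | inj₁ p = inner≢leg (sym p)
  ... | inj₂ p = inner≢leg (trans (opposite-inner d) (sym p))

  In : V Γ → Set
  In v = ∃[ i ] at i ≡ v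

  enter : ∀ δ → ¬ In (tail Γ δ) → In (head Γ δ) → ∃[ h ] leg h ≡ opposite Γ δ
  enter δ out (i , p) with cover (opposite Γ δ) i (sym p)
  ... | inj₂ x = x
  ... | inj₁ (d , q) = contradiction (head B₀ d , trans (sym (head-inner d))
          (trans (cong (head Γ) q) (cong (tail Γ) (opposite² Γ δ)))) out

Open : ∀ {Γ} → Block Γ → Set
Open {Γ} β = ∀ h → ¬ Block.In β (head Γ (Block.leg β h))

module _ {Γ : Graph} (fc : FiniteCubic Γ) (β : Block Γ) where
  open FiniteCubic fc
  open Block β

  in? : ∀ v → Dec (In v)
  in? v = Fin.any? λ i → at i ≟ⱽ v

  outside : List (V Γ)
  outside = filter (¬? ∘ in?) allV

  ∈-outside : ∀ {v} → ¬ In v → v ∈ outside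
  ∈-outside {v} p = ∈-filter⁺ (¬? ∘ in?) (∈-allV v) p

  outside-∉ : ∀ {v} → v ∈ outside → ¬ In v
  outside-∉ p = proj₂ (∈-filter⁻ (¬? ∘ in?) {xs = allV} p)

  outside-Unique : Unique outside
  outside-Unique = Unique.filter⁺ (¬? ∘ in?) allV-Unique

  module _ {S : List (E Γ)} (alive : ∀ d → proj₁ (inner d) ∉ S) where
    private
      K : Graph
      K = delete Γ (_∈ S)

    innerᴷ : Dart B₀ → Dart K
    innerᴷ d = survivor fc (inner d) (alive d)

    edgeᴷ : Fin 10 → E K
    edgeᴷ e = proj₁ (innerᴷ (e , false))

    edgeᴷ-injective : ∀ {e e′} → edgeᴷ e ≡ edgeᴷ e′ → e ≡ e′
    edgeᴷ-injective {e} {e′} eq with same-edge Γ (inner (e , false)) (inner (e′ , false)) (cong value eq)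
    ... | inj₁ p = cong proj₁ (inner-injective (sym p))
    ... | inj₂ p = case inner-injective (trans p (sym (opposite-inner (e , false)))) of λ ()

    edge-innerᴷ : ∀ d → proj₁ (innerᴷ d) ≡ edgeᴷ (proj₁ d)
    edge-innerᴷ (e , false) = refl
    edge-innerᴷ (e , true) = value-injective (cong proj₁ (opposite-inner (e , false)))
      where
      value-injective : ∀ {x y : E K} → value x ≡ value y → x ≡ y
      value-injective refl = refl

    image : ∀ {i j} (w : Walk B₀ i j) → ∃[ w′ ]
      walkEdges {K} {at i} {at j} w′ ≡ map edgeᴷ (walkEdges w) × walkVertices w′ ≡ map at (walkVertices w)
    image [] = [] , refl , refl
    image {j = j} (d ∷ w) with w′ , es , vs ← image w =
      step (innerᴷ d) (tail-inner d) (head-inner d) (edge-innerᴷ d) w′ es vs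
      where
      step : ∀ {x y e es vs} (δ : Dart K) → tail K δ ≡ x → head K δ ≡ y → proj₁ δ ≡ e →
             (w′ : Walk K y (at j)) → walkEdges w′ ≡ es → walkVertices w′ ≡ vs →
             ∃[ w″ ] walkEdges {K} {x} {at j} w″ ≡ e ∷ es × walkVertices w″ ≡ x ∷ vs
      step δ refl refl refl w′ refl refl = δ ∷ w′ , refl , refl

    block-cycle : CycleAt K (at 0F)
    block-cycle with w , es , vs ← image pentagon = record
      { walk = w
      ; nonempty = λ eq → case trans (sym es) eq of λ ()
      ; unique-edges = subst Unique (sym es) (Unique.map⁺ edgeᴷ-injective pentagon-edges)
      ; unique-vertices = subst Unique (sym vs) (Unique.map⁺ at-injective pentagon-vertices)
      }

  block-cut-bound : ∀ {k S} → CyclicallyEdgeConnected k Γ → length S < k →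
                    ∀ {vs} → Unique vs → (∀ {v} → v ∈ vs → ¬ In v) → Separates fc S vs →
                    (∀ d → proj₁ (inner d) ∉ S) → vs ≡ [] ⊎ 2 + length vs ≤ length S
  block-cut-bound cyc len uniq out sep alive =
    cut-bound fc cyc len uniq sep (λ p → out p (0F , refl)) (block-cycle alive)

-- Graphs with blocks in place of crossings

-- stub d is the first piece of the dart d.  On its way an edge of G enters each block
-- through a leg and leaves it through the partner of that leg.
record Presentation (Γ G : Graph) : Set₁ where
  field
    #blocks  : ℕ
    original : V G → V Γ
    block    : Fin #blocks → Block Γ
    stub     : Dart G → Dart Γ
    edgeOf   : Dart Γ → Maybe (E G)

    block-open         : ∀ c → Open (block c)
    original-injective : ∀ {u v} → original u ≡ original v → u ≡ v
    original∉          : ∀ c v → ¬ Block.In (block c) (original v)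
    vertexView         : ∀ v → (∃[ u ] original u ≡ v) ⊎ (∃[ c ] Block.In (block c) v)
    stub-injective     : ∀ {d d′} → stub d ≡ stub d′ → d ≡ d′
    tail-stub          : ∀ d → tail Γ (stub d) ≡ original (tail G d)
    stub-cover         : ∀ δ v → tail Γ δ ≡ original v → ∃[ d ] stub d ≡ δ
    edgeOf-opposite    : ∀ δ → edgeOf (opposite Γ δ) ≡ edgeOf δ
    edgeOf-stub        : ∀ d → edgeOf (stub d) ≡ just (proj₁ d)
    edgeOf-leg         : ∀ c h → edgeOf (Block.leg (block c) h) ≡ edgeOf (Block.leg (block c) (partner h))
    edge-induction     : ∀ {A : Set} (F : Dart Γ → A) → (∀ δ → F (opposite Γ δ) ≡ F δ) →
                         (∀ c h → F (Block.leg (block c) h) ≡ F (Block.leg (block c) (partner h))) →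
                         ∀ e → F (stub (e , false)) ≡ F (stub (e , true))

  -- Opposite darts carry the same `edgeOf`, which leaves `d` and its opposite, and no dart is its
  -- own opposite. The situation arises for edges without crossings.
  stub-opposite : ∀ d d′ → stub d′ ≡ opposite Γ (stub d) → d′ ≡ opposite G d
  stub-opposite d d′ eq with same-edge G d d′ (just-injective (trans (sym (edgeOf-stub d))
      (trans (sym (edgeOf-opposite (stub d))) (trans (cong edgeOf (sym eq)) (edgeOf-stub d′)))))
  ... | inj₂ p = p
  ... | inj₁ refl = contradiction (sym eq) (opposite≢ Γ (stub d))

module _ {Γ Δ : Graph} (φ : Γ ≃ Δ) where
  open _≃_ φ

  Block-transport : Block Γ → Block Δ
  Block-transport β = record
    { at = to ∘ at ; inner = toᴰ ∘ inner ; leg = toᴰ ∘ leg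
    ; at-injective = at-injective ∘ to-injective
    ; inner-injective = inner-injective ∘ toᴰ-injective
    ; leg-injective = leg-injective ∘ toᴰ-injective
    ; inner≢leg = inner≢leg ∘ toᴰ-injective
    ; tail-inner = λ d → trans (tail-toᴰ _) (cong to (tail-inner d))
    ; tail-leg = λ d → trans (tail-toᴰ _) (cong to (tail-leg d))
    ; opposite-inner = λ d → trans (cong toᴰ (opposite-inner d)) (opposite-toᴰ _)
    ; cover = cover′
    }
    where
    open Block β
    cover′ : ∀ δ i → tail Δ δ ≡ to (at i) → (∃[ d ] toᴰ (inner d) ≡ δ) ⊎ (∃[ h ] toᴰ (leg h) ≡ δ)
    cover′ δ i eq with cover (fromᴰ δ) i (to-injective
        (trans (sym (tail-toᴰ _)) (trans (cong (tail Δ) (toᴰ-fromᴰ δ)) eq)))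
    ... | inj₁ (d , p) = inj₁ (d , trans (cong toᴰ p) (toᴰ-fromᴰ δ))
    ... | inj₂ (d , p) = inj₂ (d , trans (cong toᴰ p) (toᴰ-fromᴰ δ))

  Presentation-transport : ∀ {G} → Presentation Γ G → Presentation Δ G
  Presentation-transport {G} P = record
    { #blocks = #blocks ; original = to ∘ original ; block = Block-transport ∘ block
    ; stub = toᴰ ∘ stub ; edgeOf = edgeOf ∘ fromᴰ
    ; block-open = λ c h (i , p) → block-open c h (i , to-injective (trans p
        (trans (cong (tail Δ) (sym (opposite-toᴰ _))) (tail-toᴰ _))))
    ; original-injective = original-injective ∘ to-injective
    ; original∉ = λ c v (i , p) → original∉ c v (i , to-injective p)
    ; vertexView = vertexView′
    ; stub-injective = stub-injective ∘ toᴰ-injective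
    ; tail-stub = λ d → trans (tail-toᴰ _) (cong to (tail-stub d))
    ; stub-cover = stub-cover′
    ; edgeOf-opposite = λ δ → trans (cong edgeOf (_≃_.opposite-toᴰ (≃-sym φ) δ)) (edgeOf-opposite _)
    ; edgeOf-stub = λ d → trans (cong edgeOf (fromᴰ-toᴰ _)) (edgeOf-stub d)
    ; edgeOf-leg = λ c h → trans (cong edgeOf (fromᴰ-toᴰ _))
        (trans (edgeOf-leg c h) (cong edgeOf (sym (fromᴰ-toᴰ _))))
    ; edge-induction = λ F inv leg-inv → edge-induction (F ∘ toᴰ)
        (λ δ → trans (cong F (opposite-toᴰ δ)) (inv _)) leg-inv
    }
    where
    open Presentation P
    vertexView′ : ∀ v → (∃[ u ] to (original u) ≡ v) ⊎ (∃[ c ] Block.In (Block-transport (block c)) v)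
    vertexView′ v with vertexView (from v)
    ... | inj₁ (u , p) = inj₁ (u , trans (cong to p) (to-from v))
    ... | inj₂ (c , i , p) = inj₂ (c , i , trans (cong to p) (to-from v))
    stub-cover′ : ∀ δ v → tail Δ δ ≡ to (original v) → ∃[ d ] toᴰ (stub d) ≡ δ
    stub-cover′ δ v eq with stub-cover (fromᴰ δ) v (to-injective
        (trans (sym (tail-toᴰ _)) (trans (cong (tail Δ) (toᴰ-fromᴰ δ)) eq)))
    ... | d , p = d , trans (cong toᴰ p) (toᴰ-fromᴰ δ)

-- The presentation given by a drawing

module _ {G : Graph} (X : Crossings G) (ρ : Wiring (Crossings.#crossings X)) where
  open Crossings X
  open Wiring ρ

  private
    Γ : Graph
    Γ = replaceCrossings X ρ

    passing : ∃[ e ] Fin (#passes e) → Fin #crossings × Bool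
    passing = Inverse.to pass
    passed : Fin #crossings × Bool → ∃[ e ] Fin (#passes e)
    passed = Inverse.from pass
    passed-passing : ∀ x → passed (passing x) ≡ x
    passed-passing x = Inverse.inverseʳ pass refl
    passing-passed : ∀ x → passing (passed x) ≡ x
    passing-passed x = Inverse.inverseˡ pass refl

    isPrime : HalfEdge → Bool
    isPrime a  = false
    isPrime a′ = true
    isPrime b  = false
    isPrime b′ = true

    cancel : ∀ x y → (x xor y) xor y ≡ x
    cancel false false = refl
    cancel false true  = refl
    cancel true  false = refl
    cancel true  true  = refl

    -- `strand` and `direction` together invert `halfEdge`: adding the bits `exchange` and `reverse`
    -- a second time cancels them.
    strand : Fin #crossings → HalfEdge → Bool
    strand c h = isB h xor exchange c
    direction : Fin #crossings → HalfEdge → Bool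
    direction c h = isPrime h xor reverse c (strand c h)

    halfEdge-side : ∀ c h → halfEdge c (strand c h) (direction c h) ≡ h
    halfEdge-side c h
      rewrite cancel (isB h) (exchange c) | cancel (isPrime h) (reverse c (strand c h)) with h
    ... | a  = refl
    ... | a′ = refl
    ... | b  = refl
    ... | b′ = refl

    isB-halfEdge : ∀ c s t → isB (halfEdge c s t) ≡ s xor exchange c
    isB-halfEdge c s t with s xor exchange c | t xor reverse c s
    ... | false | false = refl
    ... | false | true  = refl
    ... | true  | false = refl
    ... | true  | true  = refl

    isPrime-halfEdge : ∀ c s t → isPrime (halfEdge c s t) ≡ t xor reverse c s
    isPrime-halfEdge c s t with s xor exchange c | t xor reverse c s
    ... | false | false = refl
    ... | false | true  = refl
    ... | true  | false = refl
    ... | true  | true  = refl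

    partner-halfEdge : ∀ c s → partner (halfEdge c s false) ≡ halfEdge c s true
    partner-halfEdge c s with s xor exchange c | reverse c s
    ... | false | false = refl
    ... | false | true  = refl
    ... | true  | false = refl
    ... | true  | true  = refl

    strand-halfEdge : ∀ c s t → strand c (halfEdge c s t) ≡ s
    strand-halfEdge c s t = trans (cong (_xor exchange c) (isB-halfEdge c s t)) (cancel s (exchange c))

    direction-halfEdge : ∀ c s t → direction c (halfEdge c s t) ≡ t
    direction-halfEdge c s t =
      trans (cong₂ (λ p s → p xor reverse c s) (isPrime-halfEdge c s t) (strand-halfEdge c s t))
            (cancel t (reverse c s))

    -- The crossing `i` of an edge lies between its pieces `inject₁ i` and `suc i`. The dart leaves
    -- the crossing towards the given end of the edge.
    sideOf : ∃[ e ] Fin (#passes e) → Bool → Dart Γ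
    sideOf (e , i) true  = inj₁ (e , suc i) , false
    sideOf (e , i) false = inj₁ (e , inject₁ i) , true

    legOf : Fin #crossings → HalfEdge → Dart Γ
    legOf c h = sideOf (passed (c , strand c h)) (direction c h)

    legOf-halfEdge : ∀ c s t → legOf c (halfEdge c s t) ≡ sideOf (passed (c , s)) t
    legOf-halfEdge c s t = cong₂ (λ s t → sideOf (passed (c , s)) t)
      (strand-halfEdge c s t) (direction-halfEdge c s t)

    stubOf : Dart G → Dart Γ
    stubOf (e , false) = inj₁ (e , zero) , false
    stubOf (e , true)  = inj₁ (e , fromℕ _) , true

    lastEnd : ∀ e {j : Fin (suc (#passes e))} → View j → V G ⊎ Side
    lastEnd e ‵fromℕ       = inj₁ (ends G e true)
    lastEnd e (‵inject₁ i) = inj₂ (passing (e , i) , false)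

    -- pieceEnd only unfolds once it is known whether j is zero.
    pieceEnd-true : ∀ e j → pieceEnd (e , j) true ≡ lastEnd e (view j)
    pieceEnd-true e zero with Finᵇ.zero {#passes e} | view (Finᵇ.zero {#passes e})
    ... | _ | ‵fromℕ     = refl
    ... | _ | ‵inject₁ i = refl
    pieceEnd-true e (suc i) with Finᵇ.suc i | view (Finᵇ.suc i)
    ... | _ | ‵fromℕ     = refl
    ... | _ | ‵inject₁ i = refl

    pieceEnd-before : ∀ e i → pieceEnd (e , inject₁ i) true ≡ inj₂ (passing (e , i) , false)
    pieceEnd-before e i = trans (pieceEnd-true e (inject₁ i)) (cong (lastEnd e) (view-inject₁ i))

    pieceEnd-finish : ∀ e → pieceEnd (e , fromℕ _) true ≡ inj₁ (ends G e true)
    pieceEnd-finish e = trans (pieceEnd-true e (fromℕ _)) (cong (lastEnd e) (view-fromℕ _))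

    anchor : Fin #crossings × Bool → Bool → V Γ
    anchor (c , s) t = inj₂ (c , foot (halfEdge c s t))

    tail-sideOf : ∀ x t → tail Γ (sideOf x t) ≡ anchor (passing x) t
    tail-sideOf (e , i) true  = refl
    tail-sideOf (e , i) false rewrite pieceEnd-before e i = refl

    tail-legOf : ∀ c h → tail Γ (legOf c h) ≡ inj₂ (c , foot h)
    tail-legOf c h = trans (tail-sideOf (passed (c , strand c h)) (direction c h))
      (trans (cong (λ x → anchor x (direction c h)) (passing-passed (c , strand c h)))
             (cong (λ h → inj₂ (c , foot h)) (halfEdge-side c h)))

    tail-stubOf : ∀ d → tail Γ (stubOf d) ≡ inj₁ (tail G d)
    tail-stubOf (e , false) = refl
    tail-stubOf (e , true) rewrite pieceEnd-finish e = refl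

    data PieceEnd : Piece → Bool → Set where
      start  : ∀ e → PieceEnd (e , zero) false
      finish : ∀ e → PieceEnd (e , fromℕ _) true
      after  : ∀ e i → PieceEnd (e , suc i) false
      before : ∀ e i → PieceEnd (e , inject₁ i) true

    pieceView : ∀ p t → PieceEnd p t
    pieceView (e , zero) false = start e
    pieceView (e , suc i) false = after e i
    pieceView (e , i) true with view i
    ... | ‵fromℕ = finish e
    ... | ‵inject₁ j = before e j

    side-leg : ∀ x t → ∃[ h ] legOf (proj₁ (passing x)) h ≡ sideOf x t
    side-leg x t = halfEdge (proj₁ (passing x)) (proj₂ (passing x)) t ,
      trans (legOf-halfEdge (proj₁ (passing x)) (proj₂ (passing x)) t)
            (cong (λ y → sideOf y t) (passed-passing x))

    -- The two strands of a crossing belong to different edges, and each strand is a single pass. So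
    -- consecutive passes of `e` are at different crossings, which is what makes the blocks open.
    chordless : ∀ e {i i′} → suc i ≡ inject₁ i′ → proj₁ (passing (e , i)) ≢ proj₁ (passing (e , i′))
    chordless e {i} {i′} eq same = absurd (proj₂ (passing (e , i))) (proj₂ (passing (e , i′))) refl refl
      where
      c : Fin #crossings
      c = proj₁ (passing (e , i))
      pos : ∀ s → proj₂ (passing (e , i)) ≡ s → passed (c , s) ≡ (e , i)
      pos s refl = passed-passing (e , i)
      pos′ : ∀ s → proj₂ (passing (e , i′)) ≡ s → passed (c , s) ≡ (e , i′)
      pos′ s refl = trans (cong (λ c → passed (c , s)) same) (passed-passing (e , i′))
      distinct : i ≢ i′
      distinct refl = ℕ.1+n≢n (trans (cong toℕ eq) (Fin.toℕ-inject₁ i))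
      index : ∀ {x : ∃[ e ] Fin (#passes e)} → x ≡ (e , i) → x ≡ (e , i′) → ⊥
      index refl refl = distinct refl
      absurd : ∀ s s′ → proj₂ (passing (e , i)) ≡ s → proj₂ (passing (e , i′)) ≡ s′ → ⊥
      absurd false false p q = index (pos false p) (pos′ false q)
      absurd true true p q = index (pos true p) (pos′ true q)
      absurd false true p q = two-edges c (trans (cong proj₁ (pos false p)) (sym (cong proj₁ (pos′ true q))))
      absurd true false p q = two-edges c (trans (cong proj₁ (pos′ false q)) (sym (cong proj₁ (pos true p))))

    opposite-side : ∀ x t i → tail Γ (opposite Γ (sideOf x t)) ≢ inj₂ (proj₁ (passing x) , i)
    opposite-side (e , i) true j eq = far (suc i) refl (pieceView (e , suc i) true)
      where
      far : ∀ k → k ≡ suc i → PieceEnd (e , k) true → ⊥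
      far _ p (finish _) with () ← trans (sym (tail-stubOf (e , true)))
        (trans (cong (λ k → tail Γ (inj₁ (e , k) , true)) p) eq)
      far _ p (before _ i′) = chordless e (sym p) (cong proj₁ (inj₂-injective (sym (trans
        (sym (tail-sideOf (e , i′) false)) (trans (cong (λ k → tail Γ (inj₁ (e , k) , true)) p) eq)))))
    opposite-side (e , i) false j eq = far (inject₁ i) refl (pieceView (e , inject₁ i) false)
      where
      far : ∀ k → k ≡ inject₁ i → PieceEnd (e , k) false → ⊥
      far _ p (start _) with () ← trans (cong (λ k → tail Γ (inj₁ (e , k) , false)) p) eq
      far _ p (after _ i′) = chordless e p (cong proj₁ (inj₂-injective
        (trans (cong (λ k → tail Γ (inj₁ (e , k) , false)) p) eq)))

    blockOf : Fin #crossings → Block Γ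
    blockOf c = record
      { at = λ i → inj₂ (c , i)
      ; inner = λ (e , s) → inj₂ (c , e) , s
      ; leg = legOf c
      ; at-injective = λ { refl → refl }
      ; inner-injective = λ { refl → refl }
      ; leg-injective = λ {h} {h′} eq → foot-injective (cong proj₂ (inj₂-injective
          (trans (sym (tail-legOf c h)) (trans (cong (tail Γ) eq) (tail-legOf c h′)))))
      ; inner≢leg = λ {d} {h} → inner≢side d (passed (c , strand c h)) (direction c h)
      ; tail-inner = λ d → refl
      ; tail-leg = tail-legOf c
      ; opposite-inner = λ d → refl
      ; cover = coverOf
      }
      where
      inner≢side : ∀ (d : Dart B₀) x t → (inj₂ (c , proj₁ d) , proj₂ d) ≢ sideOf x t
      inner≢side d x false ()
      inner≢side d x true ()
      by-side : ∀ x t i → tail Γ (sideOf x t) ≡ inj₂ (c , i) → ∃[ h ] legOf c h ≡ sideOf x t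
      by-side x t i eq with refl ← cong proj₁ (inj₂-injective (trans (sym (tail-sideOf x t)) eq)) = side-leg x t
      coverOf : ∀ δ i → tail Γ δ ≡ inj₂ (c , i) →
                (∃[ d ] (inj₂ (c , proj₁ d) , proj₂ d) ≡ δ) ⊎ (∃[ h ] legOf c h ≡ δ)
      coverOf (inj₂ (c , e) , s) i refl = inj₁ ((e , s) , refl)
      coverOf (inj₁ p , t) i eq with pieceView p t
      ... | finish e with () ← trans (sym (tail-stubOf (e , true))) eq
      ... | after e j = inj₂ (by-side (e , j) true i eq)
      ... | before e j = inj₂ (by-side (e , j) false i eq)

    pieceEdge : Dart Γ → Maybe (E G)
    pieceEdge (inj₁ (e , _) , _) = just e
    pieceEdge (inj₂ _ , _)       = nothing

    pieceEdge-side : ∀ x t → pieceEdge (sideOf x t) ≡ just (proj₁ x)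
    pieceEdge-side x true = refl
    pieceEdge-side x false = refl

    pieceEdge-leg : ∀ c h → pieceEdge (legOf c h) ≡ just (proj₁ (passed (c , strand c h)))
    pieceEdge-leg c h = pieceEdge-side (passed (c , strand c h)) (direction c h)

  presentation : Presentation Γ G
  presentation = record
    { #blocks = #crossings
    ; original = inj₁
    ; block = blockOf
    ; stub = stubOf
    ; edgeOf = pieceEdge
    ; block-open = λ { c h (i , eq) → opposite-side (passed (c , strand c h)) (direction c h) i
        (trans (sym eq) (cong (λ x → inj₂ (proj₁ x , i)) (sym (passing-passed (c , strand c h))))) }
    ; original-injective = inj₁-injective
    ; original∉ = λ { c v (i , ()) }
    ; vertexView = λ { (inj₁ v) → inj₁ (v , refl) ; (inj₂ (c , i)) → inj₂ (c , i , refl) }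
    ; stub-injective = stubOf-injective
    ; tail-stub = tail-stubOf
    ; stub-cover = stub-cover
    ; edgeOf-opposite = λ { (inj₁ _ , _) → refl ; (inj₂ _ , _) → refl }
    ; edgeOf-stub = λ { (e , false) → refl ; (e , true) → refl }
    ; edgeOf-leg = λ c h → trans (pieceEdge-leg c h) (trans
        (cong (λ s → just (proj₁ (passed (c , s xor exchange c)))) (isB-partner h))
        (sym (pieceEdge-leg c (partner h))))
    ; edge-induction = along
    }
    where
    stubOf-injective : ∀ {d d′} → stubOf d ≡ stubOf d′ → d ≡ d′
    stubOf-injective {e , false} {e′ , false} refl = refl
    stubOf-injective {e , true} {e′ , true} eq = cong (_, true) (just-injective (cong pieceEdge eq))
    stub-cover : ∀ δ v → tail Γ δ ≡ inj₁ v → ∃[ d ] stubOf d ≡ δ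
    stub-cover (inj₁ p , t) v eq with pieceView p t
    ... | start e = (e , false) , refl
    ... | finish e = (e , true) , refl
    ... | before e i with () ← trans (sym (tail-sideOf (e , i) false)) eq
    along : ∀ {A : Set} (F : Dart Γ → A) → (∀ δ → F (opposite Γ δ) ≡ F δ) →
            (∀ c h → F (legOf c h) ≡ F (legOf c (partner h))) →
            ∀ e → F (stubOf (e , false)) ≡ F (stubOf (e , true))
    -- The induction compares the starts of the pieces; the final `inv` goes from the start of the
    -- last piece to its end, the stub at `true`.
    along F inv leg-inv e = trans (<-weakInduction Same refl next (fromℕ _)) (inv _)
      where
      Same : Fin (suc (#passes e)) → Set
      Same i = F (inj₁ (e , zero) , false) ≡ F (inj₁ (e , i) , false)
      next : ∀ i → Same (inject₁ i) → Same (suc i)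
      next i ih = trans ih (trans (sym (inv (inj₁ (e , inject₁ i) , false))) cross)
        where
        c = proj₁ (passing (e , i))
        s = proj₂ (passing (e , i))
        cross : F (sideOf (e , i) false) ≡ F (sideOf (e , i) true)
        cross = trans (cong F (sym (proj₂ (side-leg (e , i) false)))) (trans
          (leg-inv c (halfEdge c s false)) (trans (cong (F ∘ legOf c) (partner-halfEdge c s))
          (cong F (proj₂ (side-leg (e , i) true)))))

-- The forbidden cut around a block

data AtMostOne {A : Set} : List A → Set where
  none : AtMostOne []
  one  : ∀ {x} → AtMostOne (x ∷ [])

-- Otherwise the block and the vertex could be separated by three edges.
no-double-leg : ∀ {Γ} → FiniteCubic Γ → CyclicallyEdgeConnected 4 Γ →
                (G : 𝓕₅) (P : Presentation Γ (𝓕₅.graph G)) →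
                ∀ c h h′ → h ≢ h′ →
                head Γ (Block.leg (Presentation.block P c) h) ≢ head Γ (Block.leg (Presentation.block P c) h′)
no-double-leg {Γ} fc cyc G P c h h′ h≢h′ y≡ = ¬AtMostTwo G few
  where
  open Presentation P
  open FiniteCubic fc
  open Block (block c)

  y : V Γ
  y = head Γ (leg h)

  y∉ : ¬ In y
  y∉ = block-open c h

  open Third (third y (opposite Γ (leg h)) (opposite Γ (leg h′)) refl (sym y≡)
                (h≢h′ ∘ leg-injective ∘ opposite-injective Γ))

  -- The dart `d₃` may itself be the reverse of a leg; `S` then repeats an edge, which does no harm
  -- to a bound from above.
  S : List (E Γ)
  S = proj₁ d₃ ∷ map (proj₁ ∘ leg) (others h h′)

  vs : List (V Γ)
  vs = filter (λ v → ¬? (v ≟ⱽ y)) (outside fc (block c))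

  length-S : length S ≡ 3
  length-S = cong suc (trans (length-map _ (others h h′)) (length-others h h′ h≢h′))

  ∈-vs : ∀ {v} → ¬ In v → v ≢ y → v ∈ vs
  ∈-vs p q = ∈-filter⁺ (λ v → ¬? (v ≟ⱽ y)) (∈-outside fc (block c) p) q

  vs-∉ : ∀ {v} → v ∈ vs → ¬ In v
  vs-∉ p = outside-∉ fc (block c) (proj₁ (∈-filter⁻ (λ v → ¬? (v ≟ⱽ y)) p))

  vs-≢ : ∀ {v} → v ∈ vs → v ≢ y
  vs-≢ p = proj₂ (∈-filter⁻ (λ v → ¬? (v ≟ⱽ y)) {xs = outside fc (block c)} p)

  opposite-edge : ∀ {d d′} → opposite Γ d ≡ opposite Γ d′ → tail Γ d ≡ tail Γ d′
  opposite-edge eq = cong (tail Γ) (opposite-injective Γ eq)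

  leg∉vs : ∀ h {x} → x ∈ vs → x ≢ tail Γ (leg h)
  leg∉vs h p eq = vs-∉ p (foot h , trans (sym (tail-leg h)) (sym eq))

  sep : Separates fc S vs
  sep = record { leaves = leaves ; outer = outer }
    where
    leaves : ∀ d → tail Γ d ∈ vs → head Γ d ∈ vs ⊎ proj₁ d ∈ S
    leaves d t with in? fc (block c) (head Γ d) | head Γ d ≟ⱽ y
    ... | no p | no q = inj₁ (∈-vs p q)
    ... | yes p | _ with k , eq ← enter d (vs-∉ t) p = inj₂ (there
            (subst (_∈ map (proj₁ ∘ leg) (others h h′)) (cong proj₁ eq)
              (∈-map⁺ (proj₁ ∘ leg) (∈-others (not-y refl) (not-y (sym y≡))))))
      where
      not-y : ∀ {l} → head Γ (leg l) ≡ y → k ≢ l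
      not-y q refl = vs-≢ t (trans (trans (cong (tail Γ) (sym (opposite² Γ d))) (cong (head Γ) (sym eq))) q)
    leaves d t | no _ | yes q with three (opposite Γ d) q
    ... | inj₁ eq = contradiction (opposite-edge eq) (leg∉vs h t)
    ... | inj₂ (inj₁ eq) = contradiction (opposite-edge eq) (leg∉vs h′ t)
    ... | inj₂ (inj₂ eq) = inj₂ (here (cong proj₁ eq))
    outer : ∀ e → e ∈ S → ∃[ s ] ends Γ e s ∉ vs
    outer e (here refl) = proj₂ d₃ , λ p → vs-≢ p at₃
    outer e (there p) with k , _ , refl ← ∈-map⁻ (proj₁ ∘ leg) p =
      proj₂ (leg k) , λ q → leg∉vs k q refl

  alive : ∀ d → proj₁ (inner d) ∉ S
  alive d (here eq) with same-edge Γ (inner d) d₃ eq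
  ... | inj₁ p = y∉ (tail B₀ d , trans (sym (tail-inner d)) (trans (cong (tail Γ) (sym p)) at₃))
  ... | inj₂ p = y∉ (head B₀ d , trans (sym (head-inner d)) (trans (cong (tail Γ) (sym p)) at₃))
  alive d (there p) with k , _ , eq ← ∈-map⁻ (proj₁ ∘ leg) p = inner-edge≢leg-edge d k eq

  small : AtMostOne vs
  small with block-cut-bound fc (block c) cyc (ℕ.≤-reflexive (cong suc length-S))
               (Unique.filter⁺ (λ v → ¬? (v ≟ⱽ y)) (outside-Unique fc (block c))) vs-∉ sep alive
  ... | inj₁ eq = subst AtMostOne (sym eq) none
  ... | inj₂ bound = bounded vs (subst (2 + length vs ≤_) length-S bound)
    where
    bounded : ∀ {A : Set} (xs : List A) → 2 + length xs ≤ 3 → AtMostOne xs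
    bounded [] _ = none
    bounded (_ ∷ []) _ = one
    bounded (_ ∷ _ ∷ _) (s≤s (s≤s (s≤s ())))

  same : ∀ {u v} {xs : List (V Γ)} → AtMostOne xs → u ∈ xs → v ∈ xs → u ≡ v
  same one (here p) (here q) = trans p (sym q)

  -- Every vertex of `G` is `y` or lies in `vs`, and 2 + `length vs` ≤ 3.
  few : AtMostTwo (V (𝓕₅.graph G))
  few u v w with original u ≟ⱽ y | original v ≟ⱽ y | original w ≟ⱽ y
  ... | yes p | yes q | _ = inj₁ (original-injective (trans p (sym q)))
  ... | yes p | no _ | yes r = inj₂ (inj₁ (original-injective (trans p (sym r))))
  ... | no _ | yes q | yes r = inj₂ (inj₂ (original-injective (trans q (sym r))))
  ... | no p | no q | _ = inj₁ (original-injective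
          (same small (∈-vs (original∉ c u) p) (∈-vs (original∉ c v) q)))
  ... | no p | yes _ | no r = inj₂ (inj₁ (original-injective
          (same small (∈-vs (original∉ c u) p) (∈-vs (original∉ c w) r))))
  ... | yes _ | no q | no r = inj₂ (inj₂ (original-injective
          (same small (∈-vs (original∉ c v) q) (∈-vs (original∉ c w) r))))

-- Sets of vertices of the Blanuša block

all-vec? : ∀ n {P : Vec Bool n → Set} → (∀ w → Dec (P w)) → Dec (∀ w → P w)
all-vec? zero P? = map′ (λ { p [] → p }) (λ f → f []) (P? [])
all-vec? (suc n) P? = map′ (λ { (p , q) (false ∷ w) → p w ; (p , q) (true ∷ w) → q w })
  (λ f → (λ w → f (false ∷ w)) , (λ w → f (true ∷ w)))
  (all-vec? n (P? ∘ (false ∷_)) ×-dec all-vec? n (P? ∘ (true ∷_)))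

Cherry : Set
Cherry = Fin 8 × Fin 8 × Fin 8

IsCherry : Cherry → Set
IsCherry (u , v , v′) = v ≢ v′ × Adjacent u v × Adjacent u v′

isCherry? : ∀ x → Dec (IsCherry x)
isCherry? (u , v , v′) = ¬? (v Fin.≟ v′) ×-dec adjacent? u v ×-dec adjacent? u v′

triples : List Cherry
triples = cartesianProduct (allFin 8) (cartesianProduct (allFin 8) (allFin 8))

-- The path runs `u′`, `u`, `v`, `v′`; storing it as a cherry with one more vertex lets the
-- enumeration start from the filtered cherries.
IsPath : Cherry × Fin 8 → Set
IsPath ((u , v , u′) , v′) = IsCherry (u , v , u′) × Adjacent v v′

isPath? : ∀ x → Dec (IsPath x)
isPath? ((u , v , u′) , v′) = isCherry? (u , v , u′) ×-dec adjacent? v v′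

extensions : List (Cherry × Fin 8)
extensions = cartesianProduct (filter isCherry? triples) (allFin 8)

module _ (f : Fin 8 → Bool) where

  CutCherry : Cherry → Set
  CutCherry (u , v , v′) = f v ≡ not (f u) × f v′ ≡ not (f u)

  cutCherry? : ∀ x → Dec (CutCherry x)
  cutCherry? (u , v , v′) = (f v Bool.≟ not (f u)) ×-dec (f v′ Bool.≟ not (f u))

  CutPath : Cherry × Fin 8 → Set
  CutPath ((u , v , u′) , v′) = (f u ≡ true × f v ≡ true) × f u′ ≡ false × f v′ ≡ false

  cutPath? : ∀ x → Dec (CutPath x)
  cutPath? ((u , v , u′) , v′) = ((f u Bool.≟ true) ×-dec (f v Bool.≟ true)) ×-dec
                                 (f u′ Bool.≟ false) ×-dec (f v′ Bool.≟ false)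

  Constant : Set
  Constant = (∀ i → f i ≡ true) ⊎ (∀ i → f i ≡ false)

  constant? : Dec Constant
  constant? = Fin.all? (λ i → f i Bool.≟ true) ⊎-dec Fin.all? (λ i → f i Bool.≟ false)

-- The two lists are arguments so that they are evaluated only once.
cutPatterns? : ∀ xs ys → Dec (∀ (w : Vec Bool 8) →
  Constant (lookup w) ⊎ Any (CutCherry (lookup w)) xs ⊎ Any (CutPath (lookup w)) ys)
cutPatterns? xs ys = all-vec? 8 λ w →
  constant? (lookup w) ⊎-dec any? (cutCherry? (lookup w)) xs ⊎-dec any? (cutPath? (lookup w)) ys

filter-find : ∀ {A : Set} {P Q : A → Set} (P? : ∀ x → Dec (P x)) xs →
              Any Q (filter P? xs) → ∃[ x ] P x × Q x
filter-find P? xs any with x , x∈ , q ← find any = x , proj₂ (∈-filter⁻ P? {xs = xs} x∈) , q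

abstract
  -- Checked on all 256 sets. Applied to the trace of one block on another, it says that a proper
  -- nonempty trace is cut in one of two shapes, and the legs of a block admit neither.
  cutPattern : ∀ w → Constant (lookup w) ⊎ (∃[ x ] IsCherry x × CutCherry (lookup w) x)
                                         ⊎ (∃[ x ] IsPath x × CutPath (lookup w) x)
  cutPattern w = Sum.map₂ (Sum.map (filter-find isCherry? triples) (filter-find isPath? extensions))
    (from-yes (cutPatterns? (filter isCherry? triples) (filter isPath? extensions)) w)

does-true : ∀ {A : Set} (a? : Dec A) → does a? ≡ true → A
does-true (yes p) _ = p

does-false : ∀ {A : Set} (a? : Dec A) → does a? ≡ false → ¬ A
does-false (no ¬p) _ = ¬p

-- Overlapping blocks

module _ {Γ : Graph} (fc : FiniteCubic Γ) (β γ : Block Γ) (γ-open : Open γ)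
         (γ-legs : ∀ h h′ → h ≢ h′ → head Γ (Block.leg γ h) ≢ head Γ (Block.leg γ h′)) where
  private
    module β = Block β
    module γ = Block γ

    w : Vec Bool 8
    w = tabulate λ i → does (in? fc γ (β.at i))

    lookup-w : ∀ i → lookup w i ≡ does (in? fc γ (β.at i))
    lookup-w = lookup∘tabulate _

    inside : ∀ {i} → lookup w i ≡ true → γ.In (β.at i)
    inside {i} eq = does-true (in? fc γ (β.at i)) (trans (sym (lookup-w i)) eq)

    outside′ : ∀ {i} → lookup w i ≡ false → ¬ γ.In (β.at i)
    outside′ {i} eq = does-false (in? fc γ (β.at i)) (trans (sym (lookup-w i)) eq)

    exit : ∀ {i j} → Adjacent i j → lookup w i ≡ true → lookup w j ≡ false →
           ∃[ h ] tail Γ (γ.leg h) ≡ β.at i × head Γ (γ.leg h) ≡ β.at j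
    exit (d , refl , refl) p q with γ.enter (opposite Γ (β.inner d))
        (λ i → outside′ q (subst γ.In (β.head-inner d) i))
        (subst γ.In (sym (trans (cong (tail Γ) (opposite² Γ (β.inner d))) (β.tail-inner d))) (inside p))
    ... | h , eq = h , trans (cong (tail Γ) eq′) (β.tail-inner d) , trans (cong (head Γ) eq′) (β.head-inner d)
      where
      eq′ : γ.leg h ≡ β.inner d
      eq′ = trans eq (opposite² Γ (β.inner d))

    leg-at : ∀ {h h′} → tail Γ (γ.leg h) ≡ tail Γ (γ.leg h′) → h ≡ h′
    leg-at {h} {h′} eq = foot-injective (γ.at-injective (trans (sym (γ.tail-leg h)) (trans eq (γ.tail-leg h′))))

    -- If the centre is in `γ`, two legs would start at one foot. If it is outside, two legs of `γ`
    -- would end at one vertex, against `γ-legs`.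
    no-cherry : ∀ u v v′ → IsCherry (u , v , v′) → ¬ CutCherry (lookup w) (u , v , v′)
    no-cherry u v v′ (v≢v′ , uv , uv′) (p , p′) with lookup w u in eq
    ... | true with h , t , e ← exit uv eq p | h′ , t′ , e′ ← exit uv′ eq p′
               with refl ← leg-at {h} {h′} (trans t (sym t′)) = v≢v′ (β.at-injective (trans (sym e) e′))
    no-cherry u v v′ (v≢v′ , uv , uv′) (p , p′) | false
      with h , t , e ← exit (Adjacent-sym uv) p eq | h′ , t′ , e′ ← exit (Adjacent-sym uv′) p′ eq
      with h ≟ᴴ h′
    ... | yes refl = v≢v′ (β.at-injective (trans (sym t) t′))
    ... | no h≢h′ = γ-legs h h′ h≢h′ (trans e (sym e′))

    -- Both middle vertices are feet of `γ`. Their edge is not inner to `γ`, as feet are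
    -- nonadjacent, and it is not a leg, as `γ` is open.
    no-path : ∀ u v u′ v′ → IsPath ((u , v , u′) , v′) → ¬ CutPath (lookup w) ((u , v , u′) , v′)
    no-path u v u′ v′ ((_ , (d , refl , refl) , uu′) , vv′) ((pu , pv) , pu′ , pv′)
      with h , t , _ ← exit uu′ pu pu′ | h′ , t′ , _ ← exit vv′ pv pv′
      with γ.cover (β.inner d) (foot h) (trans (β.tail-inner d) (trans (sym t) (γ.tail-leg h)))
    ... | inj₂ (k , eq) = γ-open k (foot h′ , trans (sym (γ.tail-leg h′)) (trans t′
            (trans (sym (β.head-inner d)) (cong (head Γ) (sym eq)))))
    ... | inj₁ (d° , eq) = feet-nonadjacent h h′ (d° ,
            γ.at-injective (trans (sym (γ.tail-inner d°)) (trans (cong (tail Γ) eq)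
              (trans (β.tail-inner d) (trans (sym t) (γ.tail-leg h))))) ,
            γ.at-injective (trans (sym (γ.head-inner d°)) (trans (cong (head Γ) eq)
              (trans (β.head-inner d) (trans (sym t′) (γ.tail-leg h′))))))

  -- Only containment comes out here; equality of the two vertex sets is reached by exchanging the
  -- roles of the blocks.
  overlap⇒⊆ : ∀ i → γ.In (β.at i) → ∀ j → γ.In (β.at j)
  overlap⇒⊆ i p j = conclude (cutPattern w)
    where
    conclude : Constant (lookup w) ⊎ (∃[ x ] IsCherry x × CutCherry (lookup w) x)
                                   ⊎ (∃[ x ] IsPath x × CutPath (lookup w) x) → γ.In (β.at j)
    conclude (inj₁ (inj₁ always)) = inside (always j)
    conclude (inj₁ (inj₂ never)) = contradiction p (outside′ (never i))
    conclude (inj₂ (inj₁ ((u , v , v′) , cherry , cut))) = contradiction cut (no-cherry u v v′ cherry)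
    conclude (inj₂ (inj₂ (((u , v , u′) , v′) , path , cut))) = contradiction cut (no-path u v u′ v′ path)

-- Colourings of a block and of its completions

colouring : ∀ {G : Graph} (κ : Dart G → Fin 3) → (∀ d → κ (opposite G d) ≡ κ d) →
            (∀ d d′ → d ≢ d′ → tail G d ≡ tail G d′ → κ d ≢ κ d′) → ThreeEdgeColorable G
colouring {G} κ inv proper = (λ e → κ (e , false)) , λ d d′ d≢d′ t eq →
  proper d d′ d≢d′ t (trans (sym (on-dart d)) (trans eq (on-dart d′)))
  where
  on-dart : ∀ d → κ (proj₁ d , false) ≡ κ d
  on-dart (e , false) = refl
  on-dart (e , true)  = sym (inv (e , false))

ThreeEdgeColorable-transport : ∀ {G H} → G ≃ H → ThreeEdgeColorable H → ThreeEdgeColorable G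
ThreeEdgeColorable-transport φ (c , proper) = colouring (λ d → c (proj₁ (toᴰ d)))
  (λ d → cong (c ∘ proj₁) (opposite-toᴰ d))
  λ d d′ d≢d′ t → proper (toᴰ d) (toᴰ d′) (d≢d′ ∘ toᴰ-injective)
    (trans (tail-toᴰ d) (trans (cong to t) (sym (tail-toᴰ d′))))
  where open _≃_ φ

bijective⇒≃ : ∀ {G H} (to : V G → V H) (toᴰ : Dart G → Dart H) →
  (∀ {u v} → to u ≡ to v → u ≡ v) → (∀ v → ∃[ u ] to u ≡ v) →
  (∀ {d d′} → toᴰ d ≡ toᴰ d′ → d ≡ d′) → (∀ d → ∃[ d′ ] toᴰ d′ ≡ d) →
  (∀ d → tail H (toᴰ d) ≡ to (tail G d)) → (∀ d → toᴰ (opposite G d) ≡ opposite H (toᴰ d)) → G ≃ H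
bijective⇒≃ to toᴰ inj sur injᴰ surᴰ tl opp = record
  { to = to ; from = proj₁ ∘ sur
  ; from-to = λ v → inj (proj₂ (sur (to v))) ; to-from = proj₂ ∘ sur
  ; toᴰ = toᴰ ; fromᴰ = proj₁ ∘ surᴰ
  ; fromᴰ-toᴰ = λ d → injᴰ (proj₂ (surᴰ (toᴰ d))) ; toᴰ-fromᴰ = proj₂ ∘ surᴰ
  ; tail-toᴰ = tl ; opposite-toᴰ = opp }

all-dart? : ∀ {P : Dart B₀ → Set} → (∀ d → Dec (P d)) → Dec (∀ d → P d)
all-dart? P? = map′ (λ { f (e , false) → proj₁ (f e) ; f (e , true) → proj₂ (f e) })
  (λ f e → f (e , false) , f (e , true))
  (Fin.all? λ e → P? (e , false) ×-dec P? (e , true))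

-- The block together with two adjacent vertices; the half-edge h is joined to π h.
Capped : (HalfEdge → Bool) → Graph
Capped π = record
  { V    = Fin 8 ⊎ Bool
  ; E    = Fin 10 ⊎ HalfEdge ⊎ ⊤
  ; ends = λ { (inj₁ e) s → inj₁ (ends B₀ e s)
             ; (inj₂ (inj₁ h)) false → inj₁ (foot h)
             ; (inj₂ (inj₁ h)) true → inj₂ (π h)
             ; (inj₂ (inj₂ _)) s → inj₂ s } }

-- `B₀` has girth five, and joining partners to a common new vertex creates no shorter cycle, so
-- this is the cubic graph of girth five on ten vertices. The proof relies on its being one fixed
-- graph, to which both `G` and `H` can turn out to be isomorphic.
Petersen : Graph
Petersen = Capped isB

module _ (inner : Vec (Fin 3) 10) (leg : HalfEdge → Fin 3) where

  ProperAtBlock : Set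
  ProperAtBlock =
    (∀ d d′ → d ≡ d′ ⊎ tail B₀ d ≢ tail B₀ d′ ⊎ lookup inner (proj₁ d) ≢ lookup inner (proj₁ d′)) ×
    (∀ d h → tail B₀ d ≢ foot h ⊎ lookup inner (proj₁ d) ≢ leg h)

  properAtBlock? : Dec ProperAtBlock
  properAtBlock? =
    (all-dart? λ d → all-dart? λ d′ → ((d ≟ᴮ d′) ⊎-dec ¬? (tail B₀ d Fin.≟ tail B₀ d′) ⊎-dec
      ¬? (lookup inner (proj₁ d) Fin.≟ lookup inner (proj₁ d′)))) ×-dec
    (all-dart? λ d → all-half? λ h → ¬? (tail B₀ d Fin.≟ foot h) ⊎-dec
      ¬? (lookup inner (proj₁ d) Fin.≟ leg h))
    where
    _≟ᴮ_ : ∀ (d d′ : Dart B₀) → Dec (d ≡ d′)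
    (e , s) ≟ᴮ (e′ , s′) = map′ (λ { (refl , refl) → refl }) (λ { refl → refl , refl })
      ((e Fin.≟ e′) ×-dec (s Bool.≟ s′))

-- The vertices 0, 1, 2, 4, 7, 6, 5, 3 form a cycle, coloured alternately 0 and 1.
cycleColours : Vec (Fin 3) 10
cycleColours = 0F ∷ 1F ∷ 2F ∷ 1F ∷ 0F ∷ 1F ∷ 0F ∷ 2F ∷ 0F ∷ 1F ∷ []

abstract
  cycleColours-proper : ProperAtBlock cycleColours (λ _ → 2F)
  cycleColours-proper = from-yes (properAtBlock? cycleColours (λ _ → 2F))

strandColour : HalfEdge → Fin 3
strandColour a  = 0F
strandColour a′ = 0F
strandColour b  = 1F
strandColour b′ = 1F

-- This extends `strandColour` to a proper colouring of the block: partners agree, the two strands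
-- differ, and colour 2 stays free for the edge between two caps.
strandColours : Vec (Fin 3) 10
strandColours = 1F ∷ 2F ∷ 1F ∷ 2F ∷ 1F ∷ 2F ∷ 0F ∷ 0F ∷ 0F ∷ 2F ∷ []

abstract
  strandColours-proper : ProperAtBlock strandColours strandColour
  strandColours-proper = from-yes (properAtBlock? strandColours strandColour)

-- When partners are sent to different caps, each cap meets one leg of colour 0 and one of colour 1,
-- and the edge between the caps takes colour 2.
Capped-colourable : ∀ π → (∀ h h′ → h ≡ h′ ⊎ π h ≢ π h′ ⊎ strandColour h ≢ strandColour h′) →
                    ThreeEdgeColorable (Capped π)
Capped-colourable π sep = colouring κ inv proper
  where
  κ : Dart (Capped π) → Fin 3
  κ (inj₁ e , _)          = lookup strandColours e
  κ (inj₂ (inj₁ h) , _)   = strandColour h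
  κ (inj₂ (inj₂ _) , _)   = 2F
  inv : ∀ d → κ (opposite (Capped π) d) ≡ κ d
  inv (inj₁ e , _)        = refl
  inv (inj₂ (inj₁ h) , _) = refl
  inv (inj₂ (inj₂ _) , _) = refl
  ≢2 : ∀ h → strandColour h ≢ 2F
  ≢2 a ()
  ≢2 a′ ()
  ≢2 b ()
  ≢2 b′ ()
  proper : ∀ d d′ → d ≢ d′ → tail (Capped π) d ≡ tail (Capped π) d′ → κ d ≢ κ d′
  proper (inj₁ e , s) (inj₁ e′ , s′) d≢ t eq with proj₁ strandColours-proper (e , s) (e′ , s′)
  ... | inj₁ p = d≢ (cong (λ (e , s) → inj₁ e , s) p)
  ... | inj₂ (inj₁ p) = p (inj₁-injective t)
  ... | inj₂ (inj₂ p) = p eq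
  proper (inj₁ e , s) (inj₂ (inj₁ h) , false) d≢ t eq with proj₂ strandColours-proper (e , s) h
  ... | inj₁ p = p (inj₁-injective t)
  ... | inj₂ p = p eq
  proper (inj₂ (inj₁ h) , false) (inj₁ e , s) d≢ t eq with proj₂ strandColours-proper (e , s) h
  ... | inj₁ p = p (inj₁-injective (sym t))
  ... | inj₂ p = p (sym eq)
  proper (inj₂ (inj₁ h) , false) (inj₂ (inj₁ h′) , false) d≢ t eq
    with refl ← foot-injective (inj₁-injective t) = d≢ refl
  proper (inj₂ (inj₁ h) , true) (inj₂ (inj₁ h′) , true) d≢ t eq with sep h h′
  ... | inj₁ refl = d≢ refl
  ... | inj₂ (inj₁ p) = p (inj₂-injective t)
  ... | inj₂ (inj₂ p) = p eq
  proper (inj₂ (inj₁ h) , true) (inj₂ (inj₂ _) , _) d≢ t eq = ≢2 h eq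
  proper (inj₂ (inj₂ _) , _) (inj₂ (inj₁ h) , true) d≢ t eq = ≢2 h (sym eq)
  proper (inj₂ (inj₂ _) , s) (inj₂ (inj₂ _) , s′) d≢ t eq = d≢ (cong (inj₂ (inj₂ tt) ,_) (inj₂-injective t))

module _ {Γ : Graph} (β : Block Γ) where
  open Block β

  -- With no vertex outside, the opposite of a leg is again a leg. So all legs may take colour 2,
  -- like the chords of the Hamiltonian cycle.
  full-colourable : (∀ v → In v) → ThreeEdgeColorable Γ
  full-colourable full = colouring (κ ∘ kind) inv proper
    where
    Kind : Set
    Kind = Dart B₀ ⊎ HalfEdge
    κ : Kind → Fin 3
    κ (inj₁ (e , _)) = lookup cycleColours e
    κ (inj₂ _)       = 2F
    dart : Kind → Dart Γ
    dart (inj₁ d) = inner d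
    dart (inj₂ h) = leg h
    find-kind : ∀ δ → ∃[ k ] dart k ≡ δ
    find-kind δ with i , p ← full (tail Γ δ) with cover δ i (sym p)
    ... | inj₁ (d , q) = inj₁ d , q
    ... | inj₂ (h , q) = inj₂ h , q
    kind : Dart Γ → Kind
    kind δ = proj₁ (find-kind δ)
    dart-kind : ∀ δ → dart (kind δ) ≡ δ
    dart-kind δ = proj₂ (find-kind δ)
    same-kind : ∀ k k′ → dart k′ ≡ opposite Γ (dart k) → κ k′ ≡ κ k
    same-kind (inj₁ d) (inj₁ d′) eq with refl ← inner-injective (trans eq (sym (opposite-inner d))) = refl
    same-kind (inj₁ d) (inj₂ h) eq = contradiction (trans (opposite-inner d) (sym eq)) inner≢leg
    same-kind (inj₂ h) (inj₁ d) eq = contradiction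
      (trans (opposite-inner d) (trans (cong (opposite Γ) eq) (opposite² Γ (leg h)))) inner≢leg
    same-kind (inj₂ h) (inj₂ h′) eq = refl
    inv : ∀ δ → κ (kind (opposite Γ δ)) ≡ κ (kind δ)
    inv δ = same-kind (kind δ) (kind (opposite Γ δ))
      (trans (dart-kind _) (cong (opposite Γ) (sym (dart-kind δ))))
    apart : ∀ k k′ → dart k ≢ dart k′ → tail Γ (dart k) ≡ tail Γ (dart k′) → κ k ≢ κ k′
    apart (inj₁ d) (inj₁ d′) d≢ t eq with proj₁ cycleColours-proper d d′
    ... | inj₁ p = d≢ (cong inner p)
    ... | inj₂ (inj₁ p) = p (at-injective (trans (sym (tail-inner d)) (trans t (tail-inner d′))))
    ... | inj₂ (inj₂ p) = p eq
    apart (inj₁ d) (inj₂ h) d≢ t eq with proj₂ cycleColours-proper d h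
    ... | inj₁ p = p (at-injective (trans (sym (tail-inner d)) (trans t (tail-leg h))))
    ... | inj₂ p = p eq
    apart (inj₂ h) (inj₁ d) d≢ t eq with proj₂ cycleColours-proper d h
    ... | inj₁ p = p (at-injective (trans (sym (tail-inner d)) (trans (sym t) (tail-leg h))))
    ... | inj₂ p = p (sym eq)
    apart (inj₂ h) (inj₂ h′) d≢ t eq =
      d≢ (cong leg (foot-injective (at-injective (trans (sym (tail-leg h)) (trans t (tail-leg h′))))))
    proper : ∀ δ δ′ → δ ≢ δ′ → tail Γ δ ≡ tail Γ δ′ → κ (kind δ) ≢ κ (kind δ′)
    proper δ δ′ δ≢ t = apart (kind δ) (kind δ′)
      (λ eq → δ≢ (trans (sym (dart-kind δ)) (trans eq (dart-kind δ′))))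
      (trans (cong (tail Γ) (dart-kind δ)) (trans t (cong (tail Γ) (sym (dart-kind δ′)))))

-- A block and two more vertices

record Pairing (π : HalfEdge → Bool) : Set where
  field
    fst snd : Bool → HalfEdge
    π-fst   : ∀ t → π (fst t) ≡ t
    π-snd   : ∀ t → π (snd t) ≡ t
    fst≢snd : ∀ t → fst t ≢ snd t
    only    : ∀ h → h ≡ fst (π h) ⊎ h ≡ snd (π h)

module _ {Γ : Graph} (fc : FiniteCubic Γ) (β : Block Γ) (β-open : Open β)
         (pt : Bool → V Γ) (pt-injective : ∀ {s t} → pt s ≡ pt t → s ≡ t)
         (pt∉ : ∀ t → ¬ Block.In β (pt t)) (exhaust : ∀ v → ¬ Block.In β v → ∃[ t ] v ≡ pt t)
         (π : HalfEdge → Bool) (heads : ∀ h → head Γ (Block.leg β h) ≡ pt (π h))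
         (pairing : Pairing π) where
  open FiniteCubic fc
  open Block β
  open Pairing pairing

  private
    toLeg : HalfEdge → Dart Γ
    toLeg h = opposite Γ (leg h)

    toLeg-injective : ∀ {h h′} → toLeg h ≡ toLeg h′ → h ≡ h′
    toLeg-injective = leg-injective ∘ opposite-injective Γ

    leg∉ : ∀ h t → tail Γ (leg h) ≢ pt t
    leg∉ h t eq = pt∉ t (foot h , trans (sym (tail-leg h)) eq)

    at-pt : ∀ h t → π h ≡ t → head Γ (leg h) ≡ pt t
    at-pt h t refl = heads h

    module Mid (t : Bool) = Third (third (pt t) (toLeg (fst t)) (toLeg (snd t))
      (at-pt _ t (π-fst t)) (at-pt _ t (π-snd t)) (fst≢snd t ∘ toLeg-injective))

    mid : Bool → Dart Γ
    mid t = Mid.d₃ t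

    tail-mid : ∀ t → tail Γ (mid t) ≡ pt t
    tail-mid t = Mid.at₃ t

    mid≢toLeg : ∀ t h → mid t ≢ toLeg h
    mid≢toLeg t h eq with refl ← pt-injective (trans (sym (tail-mid t)) (trans (cong (tail Γ) eq) (heads h)))
      with only h
    ... | inj₁ p = Mid.≢₁ t (trans eq (cong toLeg p))
    ... | inj₂ p = Mid.≢₂ t (trans eq (cong toLeg p))

    outside-dart : ∀ δ t → tail Γ δ ≡ pt t → (∃[ h ] δ ≡ toLeg h) ⊎ δ ≡ mid t
    outside-dart δ t eq with Mid.three t δ eq
    ... | inj₁ p = inj₁ (_ , p)
    ... | inj₂ (inj₁ p) = inj₁ (_ , p)
    ... | inj₂ (inj₂ p) = inj₂ p

    not-leg : ∀ t h → opposite Γ (mid t) ≢ toLeg h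
    not-leg t h eq = leg∉ h t (trans (cong (tail Γ) (sym (opposite-injective Γ eq))) (tail-mid t))

    -- The third dart at `pt t` cannot enter the block, for it would be the reverse of a leg. Its
    -- head is then some `pt t′` where its opposite must be `mid t′`, and `t′` = `t` would make a
    -- dart its own opposite.
    opposite-mid : ∀ t → mid (not t) ≡ opposite Γ (mid t)
    opposite-mid t with in? fc β (head Γ (mid t))
    ... | yes p with h , eq ← enter (mid t) (pt∉ t ∘ subst In (tail-mid t)) p =
      contradiction (trans (sym (opposite² Γ (mid t))) (cong (opposite Γ) (sym eq))) (mid≢toLeg t h)
    ... | no p with exhaust _ p
    ...   | t′ , eq with outside-dart (opposite Γ (mid t)) t′ eq
    ...     | inj₁ (h , q) = contradiction q (not-leg t h)
    ...     | inj₂ q with t Bool.≟ t′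
    ...       | yes refl = contradiction q (opposite≢ Γ (mid t))
    ...       | no t≢t′ = trans (cong mid (other t t′ t≢t′)) (sym q)
      where
      other : ∀ s s′ → s ≢ s′ → not s ≡ s′
      other false false p = contradiction refl p
      other false true  p = refl
      other true  false p = refl
      other true  true  p = contradiction refl p

    to : Fin 8 ⊎ Bool → V Γ
    to (inj₁ i) = at i
    to (inj₂ t) = pt t

    to-inj : ∀ {u v} → to u ≡ to v → u ≡ v
    to-inj {inj₁ i} {inj₁ j} eq = cong inj₁ (at-injective eq)
    to-inj {inj₁ i} {inj₂ t} eq = contradiction (i , eq) (pt∉ t)
    to-inj {inj₂ t} {inj₁ i} eq = contradiction (i , sym eq) (pt∉ t)
    to-inj {inj₂ s} {inj₂ t} eq = cong inj₂ (pt-injective eq)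

    toᴰ : Dart (Capped π) → Dart Γ
    toᴰ (inj₁ e , s)            = inner (e , s)
    toᴰ (inj₂ (inj₁ h) , false) = leg h
    toᴰ (inj₂ (inj₁ h) , true)  = toLeg h
    toᴰ (inj₂ (inj₂ _) , s)     = mid s

    tail-toᴰ : ∀ d → tail Γ (toᴰ d) ≡ to (tail (Capped π) d)
    tail-toᴰ (inj₁ e , s)            = tail-inner (e , s)
    tail-toᴰ (inj₂ (inj₁ h) , false) = tail-leg h
    tail-toᴰ (inj₂ (inj₁ h) , true)  = heads h
    tail-toᴰ (inj₂ (inj₂ _) , s)     = tail-mid s

    opposite-toᴰ : ∀ d → toᴰ (opposite (Capped π) d) ≡ opposite Γ (toᴰ d)
    opposite-toᴰ (inj₁ e , s)            = opposite-inner (e , s)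
    opposite-toᴰ (inj₂ (inj₁ h) , false) = refl
    opposite-toᴰ (inj₂ (inj₁ h) , true)  = sym (opposite² Γ (leg h))
    opposite-toᴰ (inj₂ (inj₂ _) , s)     = opposite-mid s

    toᴰ-inj : ∀ d d′ → tail (Capped π) d ≡ tail (Capped π) d′ → toᴰ d ≡ toᴰ d′ → d ≡ d′
    toᴰ-inj (inj₁ e , s) (inj₁ e′ , s′) t eq with refl ← inner-injective eq = refl
    toᴰ-inj (inj₁ e , s) (inj₂ (inj₁ h) , false) t eq = contradiction eq inner≢leg
    toᴰ-inj (inj₂ (inj₁ h) , false) (inj₁ e , s) t eq = contradiction (sym eq) inner≢leg
    toᴰ-inj (inj₂ (inj₁ h) , false) (inj₂ (inj₁ h′) , false) t eq with refl ← leg-injective eq = refl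
    toᴰ-inj (inj₂ (inj₁ h) , true) (inj₂ (inj₁ h′) , true) t eq with refl ← toLeg-injective eq = refl
    toᴰ-inj (inj₂ (inj₁ h) , true) (inj₂ (inj₂ _) , s) t eq = contradiction (sym eq) (mid≢toLeg s h)
    toᴰ-inj (inj₂ (inj₂ _) , s) (inj₂ (inj₁ h) , true) t eq = contradiction eq (mid≢toLeg s h)
    toᴰ-inj (inj₂ (inj₂ _) , s) (inj₂ (inj₂ _) , s′) refl eq = refl

    to-sur : ∀ v → ∃[ u ] to u ≡ v
    to-sur v with in? fc β v
    ... | yes (i , p) = inj₁ i , p
    ... | no p with t , eq ← exhaust v p = inj₂ t , sym eq

    toᴰ-sur : ∀ δ → ∃[ d ] toᴰ d ≡ δ
    toᴰ-sur δ with to-sur (tail Γ δ)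
    ... | inj₂ t , p with outside-dart δ t (sym p)
    ...   | inj₁ (h , q) = (inj₂ (inj₁ h) , true) , sym q
    ...   | inj₂ q = (inj₂ (inj₂ tt) , t) , sym q
    toᴰ-sur δ | inj₁ i , p with cover δ i (sym p)
    ...   | inj₁ ((e , s) , q) = (inj₁ e , s) , q
    ...   | inj₂ (h , q) = (inj₂ (inj₁ h) , false) , q

  Capped-≃ : Capped π ≃ Γ
  Capped-≃ = bijective⇒≃ to toᴰ to-inj to-sur
    (λ {d} {d′} eq → toᴰ-inj d d′ (to-inj (trans (sym (tail-toᴰ d)) (trans (cong (tail Γ) eq) (tail-toᴰ d′)))) eq)
    toᴰ-sur tail-toᴰ opposite-toᴰ

isB-pairing : Pairing isB
isB-pairing = record
  { fst = λ { false → a ; true → b } ; snd = λ { false → a′ ; true → b′ }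
  ; π-fst = λ { false → refl ; true → refl } ; π-snd = λ { false → refl ; true → refl }
  ; fst≢snd = λ { false () ; true () }
  ; only = λ { a → inj₁ refl ; a′ → inj₂ refl ; b → inj₁ refl ; b′ → inj₂ refl } }

across across′ : HalfEdge → Bool
across a  = false
across a′ = true
across b  = false
across b′ = true
across′ a  = false
across′ a′ = true
across′ b  = true
across′ b′ = false

across-pairing : Pairing across
across-pairing = record
  { fst = λ { false → a ; true → a′ } ; snd = λ { false → b ; true → b′ }
  ; π-fst = λ { false → refl ; true → refl } ; π-snd = λ { false → refl ; true → refl }
  ; fst≢snd = λ { false () ; true () }
  ; only = λ { a → inj₁ refl ; a′ → inj₁ refl ; b → inj₂ refl ; b′ → inj₂ refl } }

across′-pairing : Pairing across′
across′-pairing = record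
  { fst = λ { false → a ; true → a′ } ; snd = λ { false → b′ ; true → b }
  ; π-fst = λ { false → refl ; true → refl } ; π-snd = λ { false → refl ; true → refl }
  ; fst≢snd = λ { false () ; true () }
  ; only = λ { a → inj₁ refl ; a′ → inj₁ refl ; b → inj₂ refl ; b′ → inj₂ refl } }

Mixing : (HalfEdge → Bool) → Set
Mixing π = ∀ h h′ → h ≡ h′ ⊎ π h ≢ π h′ ⊎ strandColour h ≢ strandColour h′

partner-mixing : ∀ π → (∀ h → π (partner h) ≢ π h) → Mixing π
partner-mixing π mix a  a  = inj₁ refl
partner-mixing π mix a  a′ = inj₂ (inj₁ (mix a′))
partner-mixing π mix a  b  = inj₂ (inj₂ λ ())
partner-mixing π mix a  b′ = inj₂ (inj₂ λ ())
partner-mixing π mix a′ a  = inj₂ (inj₁ (mix a))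
partner-mixing π mix a′ a′ = inj₁ refl
partner-mixing π mix a′ b  = inj₂ (inj₂ λ ())
partner-mixing π mix a′ b′ = inj₂ (inj₂ λ ())
partner-mixing π mix b  a  = inj₂ (inj₂ λ ())
partner-mixing π mix b  a′ = inj₂ (inj₂ λ ())
partner-mixing π mix b  b  = inj₁ refl
partner-mixing π mix b  b′ = inj₂ (inj₁ (mix b′))
partner-mixing π mix b′ a  = inj₂ (inj₂ λ ())
partner-mixing π mix b′ a′ = inj₂ (inj₂ λ ())
partner-mixing π mix b′ b  = inj₂ (inj₁ (mix b))
partner-mixing π mix b′ b′ = inj₁ refl

-- Cyclically 5-edge-connected snarks that contain a block

module _ (H : 𝓕₅) (β : Block (𝓕₅.graph H)) where
  private
    Γ : Graph
    Γ = 𝓕₅.graph H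
    fc : FiniteCubic Γ
    fc = finiteCubic (𝓕₅.snark H)
  open FiniteCubic fc
  open Block β

  private
    uncolourable : ¬ ThreeEdgeColorable Γ
    uncolourable = Snark.not-3-edge-colorable (𝓕₅.snark H)

    toLeg : HalfEdge → Dart Γ
    toLeg h = opposite Γ (leg h)

    toLeg-injective : ∀ {h h′} → toLeg h ≡ toLeg h′ → h ≡ h′
    toLeg-injective = leg-injective ∘ opposite-injective Γ

    abstract
      -- The cut consists of legs alone. That all four may be taken is what the cyclic
      -- 5-edge-connectivity of `H` provides.
      legs-bound : ∀ L vs → length L < 5 → Unique vs → (∀ {v} → v ∈ vs → ¬ In v) →
                   (∀ d → tail Γ d ∈ vs → head Γ d ∈ vs ⊎ (∃[ h ] h ∈ L × leg h ≡ opposite Γ d)) →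
                   vs ≡ [] ⊎ 2 + length vs ≤ length L
      legs-bound L vs len uniq out leave = subst (λ k → vs ≡ [] ⊎ 2 + length vs ≤ k) (length-map (proj₁ ∘ leg) L)
        (block-cut-bound fc β (𝓕₅.cyclically-5-edge-connected H)
          (subst (_< 5) (sym (length-map (proj₁ ∘ leg) L)) len) uniq out sep still)
        where
        S : List (E Γ)
        S = map (proj₁ ∘ leg) L
        sep : Separates fc S vs
        sep = record { leaves = leaves ; outer = outer }
          where
          leaves : ∀ d → tail Γ d ∈ vs → head Γ d ∈ vs ⊎ proj₁ d ∈ S
          leaves d t with leave d t
          ... | inj₁ p = inj₁ p
          ... | inj₂ (h , h∈ , eq) = inj₂ (subst (_∈ S) (cong proj₁ eq) (∈-map⁺ (proj₁ ∘ leg) h∈))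
          outer : ∀ e → e ∈ S → ∃[ s ] ends Γ e s ∉ vs
          outer e p with h , _ , refl ← ∈-map⁻ (proj₁ ∘ leg) p =
            proj₂ (leg h) , λ q → out q (foot h , sym (tail-leg h))
        still : ∀ d → proj₁ (inner d) ∉ S
        still d p with h , _ , eq ← ∈-map⁻ (proj₁ ∘ leg) p = inner-edge≢leg-edge d h eq

    -- A leg that returned would be the reverse of another leg. The two remaining legs would then
    -- cut off all outside vertices, the count leaves none, and a graph consisting of the block
    -- alone is colourable.
    β-open : Open β
    β-open h (i , p) with cover (toLeg h) i (sym p)
    ... | inj₁ (d , eq) = inner≢leg (trans (opposite-inner d)
            (trans (cong (opposite Γ) eq) (opposite² Γ (leg h))))
    ... | inj₂ (h′ , eq) = uncolourable (full-colourable β full)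
      where
      h≢h′ : h ≢ h′
      h≢h′ refl = opposite≢ Γ (leg h) (sym eq)
      not-toLeg : ∀ d k → tail Γ d ∈ outside fc β → d ≢ leg k
      not-toLeg d k t refl = outside-∉ fc β t (foot k , sym (tail-leg k))
      leave : ∀ d → tail Γ d ∈ outside fc β → head Γ d ∈ outside fc β ⊎
              (∃[ k ] k ∈ others h h′ × leg k ≡ opposite Γ d)
      leave d t with in? fc β (head Γ d)
      ... | no q = inj₁ (∈-outside fc β q)
      ... | yes q with k , e ← enter d (outside-∉ fc β t) q = inj₂ (k , ∈-others k≢h k≢h′ , e)
        where
        k≢h : k ≢ h
        k≢h refl = not-toLeg d h′ t (trans (sym (opposite² Γ d)) (trans (cong (opposite Γ) (sym e)) (sym eq)))
        k≢h′ : k ≢ h′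
        k≢h′ refl = not-toLeg d h t (opposite-injective Γ (trans (sym e) eq))
      empty : outside fc β ≡ []
      empty with legs-bound (others h h′) (outside fc β)
                   (subst (_< 5) (sym (length-others h h′ h≢h′)) (s≤s (s≤s (s≤s z≤n))))
                   (outside-Unique fc β) (outside-∉ fc β) leave
      ... | inj₁ p = p
      ... | inj₂ bound with outside fc β | subst (_ ≤_) (length-others h h′ h≢h′) bound
      ...   | [] | _ = refl
      ...   | _ ∷ _ | s≤s (s≤s ())
      full : ∀ v → In v
      full v = decidable-stable (in? fc β v) λ v∉ →
        case subst (v ∈_) empty (∈-outside fc β v∉) of λ ()

    outside-small : length (outside fc β) ≤ 2
    outside-small with legs-bound halfEdges (outside fc β) (s≤s (s≤s (s≤s (s≤s (s≤s z≤n)))))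
                         (outside-Unique fc β) (outside-∉ fc β) leave
      where
      leave : ∀ d → tail Γ d ∈ outside fc β → head Γ d ∈ outside fc β ⊎
              (∃[ k ] k ∈ halfEdges × leg k ≡ opposite Γ d)
      leave d t with in? fc β (head Γ d)
      ... | no q = inj₁ (∈-outside fc β q)
      ... | yes q with k , e ← enter d (outside-∉ fc β t) q = inj₂ (k , ∈-halfEdges k , e)
    ... | inj₁ p = subst (λ vs → length vs ≤ 2) (sym p) z≤n
    ... | inj₂ (s≤s (s≤s bound)) = bound

    two-outside : ∀ {u v w} → u ≢ v → ¬ In u → ¬ In v → ¬ In w → w ≡ u ⊎ w ≡ v
    two-outside {u} {v} {w} u≢v u∉ v∉ w∉ = pick outside-small
      (∈-outside fc β u∉) (∈-outside fc β v∉) (∈-outside fc β w∉)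
      where
      pick : ∀ {vs} → length vs ≤ 2 → u ∈ vs → v ∈ vs → w ∈ vs → w ≡ u ⊎ w ≡ v
      pick _ (here p) _ (here r) = inj₁ (trans r (sym p))
      pick _ (there (here p)) _ (there (here r)) = inj₁ (trans r (sym p))
      pick _ _ (here q) (here r) = inj₂ (trans r (sym q))
      pick _ _ (there (here q)) (there (here r)) = inj₂ (trans r (sym q))
      pick _ (here p) (here q) _ = contradiction (trans p (sym q)) u≢v
      pick _ (there (here p)) (there (here q)) _ = contradiction (trans p (sym q)) u≢v
      pick {_ ∷ _ ∷ []} _ (there (there ())) _ _
      pick {_ ∷ _ ∷ []} _ _ (there (there ())) _
      pick {_ ∷ _ ∷ []} _ _ _ (there (there ()))
      pick {_ ∷ _ ∷ _ ∷ _} (s≤s (s≤s ())) _ _ _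

    saturated : ∀ {w} h₁ h₂ h₃ → Unique (h₁ ∷ h₂ ∷ h₃ ∷ []) →
                (∀ {h} → h ∈ h₁ ∷ h₂ ∷ h₃ ∷ [] → head Γ (leg h) ≡ w) →
                ∀ δ → tail Γ δ ≡ w → ∃[ h ] h ∈ h₁ ∷ h₂ ∷ h₃ ∷ [] × δ ≡ toLeg h
    saturated {w} h₁ h₂ h₃ ((n₁₂ ∷ n₁₃ ∷ []) ∷ (n₂₃ ∷ []) ∷ _) heads δ t = result (three δ t)
      where
      open Third (third w (toLeg h₁) (toLeg h₂) (heads (here refl)) (heads (there (here refl)))
                        (n₁₂ ∘ toLeg-injective))
      h₃-third : toLeg h₃ ≡ d₃
      h₃-third with three (toLeg h₃) (heads (there (there (here refl))))
      ... | inj₁ p = contradiction (sym (toLeg-injective p)) n₁₃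
      ... | inj₂ (inj₁ p) = contradiction (sym (toLeg-injective p)) n₂₃
      ... | inj₂ (inj₂ p) = p
      result : δ ≡ toLeg h₁ ⊎ δ ≡ toLeg h₂ ⊎ δ ≡ d₃ → ∃[ h ] h ∈ h₁ ∷ h₂ ∷ h₃ ∷ [] × δ ≡ toLeg h
      result (inj₁ p) = h₁ , here refl , p
      result (inj₂ (inj₁ p)) = h₂ , there (here refl) , p
      result (inj₂ (inj₂ p)) = h₃ , there (there (here refl)) , trans p (sym h₃-third)

    -- Three legs use up all darts at `w`, so the fourth leg would be the only edge between `z` and
    -- the rest, and the count would give 3 ≤ 1.
    no-3-1-split : ∀ h₁ h₂ h₃ h₄ → Unique (h₁ ∷ h₂ ∷ h₃ ∷ []) → (∀ h → h ∈ h₄ ∷ h₁ ∷ h₂ ∷ h₃ ∷ []) →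
                   ∀ {w z} → w ≢ z → (∀ {h} → h ∈ h₁ ∷ h₂ ∷ h₃ ∷ [] → head Γ (leg h) ≡ w) →
                   head Γ (leg h₄) ≢ z
    no-3-1-split h₁ h₂ h₃ h₄ uniq all {w} {z} w≢z heads h₄≡ with legs-bound (h₄ ∷ []) (z ∷ [])
        (s≤s (s≤s z≤n)) ([] ∷ []) (λ { (here refl) → z∉ }) leave
      where
      z∉ : ¬ In z
      z∉ = subst (¬_ ∘ In) h₄≡ (β-open h₄)
      w∉ : ¬ In w
      w∉ = subst (¬_ ∘ In) (heads (here refl)) (β-open h₁)
      leave : ∀ d → tail Γ d ∈ z ∷ [] → head Γ d ∈ z ∷ [] ⊎
              (∃[ k ] k ∈ h₄ ∷ [] × leg k ≡ opposite Γ d)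
      leave d (here t) with in? fc β (head Γ d)
      ... | yes p with k , e ← enter d (λ q → z∉ (subst In t q)) p with all k
      ...   | here refl = inj₂ (k , here refl , e)
      ...   | there k∈ = contradiction (trans (sym (heads k∈)) (trans (cong (head Γ) e)
                (trans (cong (tail Γ) (opposite² Γ d)) t))) w≢z
      leave d (here t) | no p with two-outside w≢z w∉ z∉ p
      ... | inj₂ q = inj₁ (here q)
      ... | inj₁ q with h , _ , e ← saturated h₁ h₂ h₃ uniq heads (opposite Γ d) q =
        contradiction (foot h , trans (sym (tail-leg h)) (trans (cong (tail Γ) (sym (opposite-injective Γ e))) t)) z∉
    ... | inj₁ ()
    ... | inj₂ (s≤s ())

    x : V Γ
    x = head Γ (leg a)

    second-head : ∃[ k ] head Γ (leg k) ≢ x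
    second-head with head Γ (leg a′) ≟ⱽ x | head Γ (leg b) ≟ⱽ x | head Γ (leg b′) ≟ⱽ x
    ... | no p | _ | _ = a′ , p
    ... | _ | no p | _ = b , p
    ... | _ | _ | no p = b′ , p
    -- Four legs cannot all end at `x`: three of them already use up its darts.
    ... | yes p | yes q | yes r with saturated a a′ b
            (((λ ()) ∷ (λ ()) ∷ []) ∷ ((λ ()) ∷ []) ∷ [] ∷ [])
            (λ { (here refl) → refl ; (there (here refl)) → p ; (there (there (here refl))) → q })
            (toLeg b′) r
    ...   | h , h∈ , e with refl ← toLeg-injective e with h∈
    ...     | there (there (there ()))

    y : V Γ
    y = head Γ (leg (proj₁ second-head))

    x≢y : x ≢ y
    x≢y = proj₂ second-head ∘ sym

    pt : Bool → V Γ
    pt false = x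
    pt true  = y

    pt-injective : ∀ {s t} → pt s ≡ pt t → s ≡ t
    pt-injective {false} {false} _ = refl
    pt-injective {false} {true} p = contradiction p x≢y
    pt-injective {true} {false} p = contradiction (sym p) x≢y
    pt-injective {true} {true} _ = refl

    pt∉ : ∀ t → ¬ In (pt t)
    pt∉ false = β-open a
    pt∉ true  = β-open (proj₁ second-head)

    exhaust : ∀ v → ¬ In v → ∃[ t ] v ≡ pt t
    exhaust v v∉ with two-outside x≢y (pt∉ false) (pt∉ true) v∉
    ... | inj₁ p = false , p
    ... | inj₂ p = true , p

    capped : ∀ π → Pairing π → (∀ h → head Γ (leg h) ≡ pt (π h)) → Capped π ≃ Γ
    capped π pairing heads = Capped-≃ fc β β-open pt pt-injective pt∉ exhaust π heads pairing

    not-mixing : ∀ π → Pairing π → (∀ h → π (partner h) ≢ π h) → ¬ (∀ h → head Γ (leg h) ≡ pt (π h))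
    not-mixing π pairing mix heads = uncolourable (ThreeEdgeColorable-transport
      (≃-sym (capped π pairing heads)) (Capped-colourable π (partner-mixing π mix)))

    -- With `a` at `pt false` there are eight cases. `second-head` excludes the 4-0 split, a bridge
    -- excludes the four 3-1 splits, and a colouring excludes two of the 2-2 splits; the remaining
    -- one keeps partners together.
    by-heads : ∀ s t u → head Γ (leg a′) ≡ pt s → head Γ (leg b) ≡ pt t → head Γ (leg b′) ≡ pt u →
               Petersen ≃ Γ
    by-heads false true true p q r = capped isB isB-pairing λ { a → refl ; a′ → p ; b → q ; b′ → r }
    by-heads true false true p q r = ⊥-elim (not-mixing across across-pairing
      (λ { a () ; a′ () ; b () ; b′ () }) λ { a → refl ; a′ → p ; b → q ; b′ → r })
    by-heads true true false p q r = ⊥-elim (not-mixing across′ across′-pairing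
      (λ { a () ; a′ () ; b () ; b′ () }) λ { a → refl ; a′ → p ; b → q ; b′ → r })
    by-heads false false false p q r = contradiction (same (proj₁ second-head)) (proj₂ second-head)
      where
      same : ∀ h → head Γ (leg h) ≡ x
      same a  = refl
      same a′ = p
      same b  = q
      same b′ = r
    by-heads false false true p q r = contradiction r (no-3-1-split a a′ b b′
      (((λ ()) ∷ (λ ()) ∷ []) ∷ ((λ ()) ∷ []) ∷ [] ∷ [])
      (λ { a → there (here refl) ; a′ → there (there (here refl)) ; b → there (there (there (here refl))) ; b′ → here refl })
      x≢y λ { (here refl) → refl ; (there (here refl)) → p ; (there (there (here refl))) → q })
    by-heads false true false p q r = contradiction q (no-3-1-split a a′ b′ b
      (((λ ()) ∷ (λ ()) ∷ []) ∷ ((λ ()) ∷ []) ∷ [] ∷ [])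
      (λ { a → there (here refl) ; a′ → there (there (here refl)) ; b′ → there (there (there (here refl))) ; b → here refl })
      x≢y λ { (here refl) → refl ; (there (here refl)) → p ; (there (there (here refl))) → r })
    by-heads true false false p q r = contradiction p (no-3-1-split a b b′ a′
      (((λ ()) ∷ (λ ()) ∷ []) ∷ ((λ ()) ∷ []) ∷ [] ∷ [])
      (λ { a → there (here refl) ; b → there (there (here refl)) ; b′ → there (there (there (here refl))) ; a′ → here refl })
      x≢y λ { (here refl) → refl ; (there (here refl)) → q ; (there (there (here refl))) → r })
    by-heads true true true p q r = contradiction refl (no-3-1-split a′ b b′ a
      (((λ ()) ∷ (λ ()) ∷ []) ∷ ((λ ()) ∷ []) ∷ [] ∷ [])
      (λ { a′ → there (here refl) ; b → there (there (here refl)) ; b′ → there (there (there (here refl))) ; a → here refl })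
      (x≢y ∘ sym) λ { (here refl) → p ; (there (here refl)) → q ; (there (there (here refl))) → r })

  Petersen-≃ : Petersen ≃ Γ
  Petersen-≃ = by-heads (proj₁ (heads a′)) (proj₁ (heads b)) (proj₁ (heads b′))
    (proj₂ (heads a′)) (proj₂ (heads b)) (proj₂ (heads b′))
    where
    heads : ∀ h → ∃[ t ] head Γ (leg h) ≡ pt t
    heads h = exhaust (head Γ (leg h)) (β-open h)

  block-leaves-two : ∀ {u v w} → ¬ In u → ¬ In v → ¬ In w → u ≡ v ⊎ u ≡ w ⊎ v ≡ w
  block-leaves-two {u} {v} {w} p q r with u ≟ⱽ v
  ... | yes u≡v = inj₁ u≡v
  ... | no u≢v with two-outside u≢v p q r
  ...   | inj₁ w≡u = inj₂ (inj₁ (sym w≡u))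
  ...   | inj₂ w≡v = inj₂ (inj₂ (sym w≡v))

-- Comparing two presentations of one graph

∃-or-∀ : ∀ {n} {A B : Fin n → Set} → (∀ i → A i ⊎ B i) → (∃[ i ] A i) ⊎ (∀ i → B i)
∃-or-∀ {zero} f = inj₂ λ ()
∃-or-∀ {suc n} f with f zero | ∃-or-∀ (f ∘ suc)
... | inj₁ p | _ = inj₁ (zero , p)
... | _ | inj₁ (i , p) = inj₁ (suc i , p)
... | inj₂ p | inj₂ q = inj₂ λ { zero → p ; (suc i) → q i }

-- An open block is an induced subgraph: a dart between two of its vertices is no leg, so it is
-- inner. Adjacency within `γ` can therefore be read off from the bare graph.
Adjacent-resp : ∀ {Γ} (β γ : Block Γ) → Open γ → ∀ {i j i′ j′} →
                Block.at β i ≡ Block.at γ i′ → Block.at β j ≡ Block.at γ j′ →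
                Adjacent i j → Adjacent i′ j′
Adjacent-resp {Γ} β γ γ-open {i′ = i′} {j′} p q (d , refl , refl)
  with Block.cover γ (Block.inner β d) i′ (trans (Block.tail-inner β d) p)
... | inj₁ (d′ , eq) = d′ ,
      Block.at-injective γ (trans (sym (Block.tail-inner γ d′)) (trans (cong (tail Γ) eq) (trans (Block.tail-inner β d) p))) ,
      Block.at-injective γ (trans (sym (Block.head-inner γ d′)) (trans (cong (head Γ) eq) (trans (Block.head-inner β d) q)))
... | inj₂ (h , eq) = contradiction (j′ , trans (sym q) (trans (sym (Block.head-inner β d)) (cong (head Γ) (sym eq)))) (γ-open h)

-- All darts at original vertices are stubs, so those at the eight vertices come from `H`. An inner
-- edge has stubs at both ends and is an uncrossed edge of `H`; a leg becomes the whole edge of `H`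
-- that begins with it.
descend : ∀ {Γ H} (Q : Presentation Γ H) (β : Block Γ) →
          (∀ i → ∃[ u ] Presentation.original Q u ≡ Block.at β i) → Block H
descend {Γ} {H} Q β orig = record
  { at = at′ ; inner = inner′ ; leg = leg′
  ; at-injective = λ {i} {j} eq → at-injective (trans (sym (proj₂ (orig i)))
      (trans (cong original eq) (proj₂ (orig j))))
  ; inner-injective = λ {d} {d′} eq → inner-injective (trans (sym (stub-inner d))
      (trans (cong stub eq) (stub-inner d′)))
  ; leg-injective = λ {h} {h′} eq → leg-injective (trans (sym (stub-leg h))
      (trans (cong stub eq) (stub-leg h′)))
  ; inner≢leg = λ {d} {h} eq → inner≢leg (trans (sym (stub-inner d)) (trans (cong stub eq) (stub-leg h)))
  ; tail-inner = λ d → tail-down (stub-inner d) (tail-inner d)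
  ; tail-leg = λ h → tail-down (stub-leg h) (tail-leg h)
  ; opposite-inner = λ d → stub-opposite (inner′ d) (inner′ (opposite B₀ d))
      (trans (stub-inner _) (trans (opposite-inner d) (cong (opposite Γ) (sym (stub-inner d)))))
  ; cover = cover′
  }
  where
  open Presentation Q
  open Block β
  at′ : Fin 8 → V H
  at′ i = proj₁ (orig i)
  down : ∀ δ {i} → tail Γ δ ≡ at i → ∃[ d ] stub d ≡ δ
  down δ {i} t = stub-cover δ (at′ i) (trans t (sym (proj₂ (orig i))))
  inner′ : Dart B₀ → Dart H
  inner′ d = proj₁ (down (inner d) (tail-inner d))
  stub-inner : ∀ d → stub (inner′ d) ≡ inner d
  stub-inner d = proj₂ (down (inner d) (tail-inner d))
  leg′ : HalfEdge → Dart H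
  leg′ h = proj₁ (down (leg h) (tail-leg h))
  stub-leg : ∀ h → stub (leg′ h) ≡ leg h
  stub-leg h = proj₂ (down (leg h) (tail-leg h))
  tail-down : ∀ {d δ i} → stub d ≡ δ → tail Γ δ ≡ at i → tail H d ≡ at′ i
  tail-down {d} {i = i} eq t = original-injective (trans (sym (tail-stub d))
    (trans (cong (tail Γ) eq) (trans t (sym (proj₂ (orig i))))))
  cover′ : ∀ d i → tail H d ≡ at′ i → (∃[ d′ ] inner′ d′ ≡ d) ⊎ (∃[ h ] leg′ h ≡ d)
  cover′ d i t with cover (stub d) i (trans (tail-stub d) (trans (cong original t) (proj₂ (orig i))))
  ... | inj₁ (d′ , eq) = inj₁ (d′ , stub-injective (trans (stub-inner d′) eq))
  ... | inj₂ (h , eq) = inj₂ (h , stub-injective (trans (stub-leg h) eq))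

module _ {Γ : Graph} (fc : FiniteCubic Γ) (cyc : CyclicallyEdgeConnected 4 Γ) where

  module Compare (G H : 𝓕₅) (P : Presentation Γ (𝓕₅.graph G)) (Q : Presentation Γ (𝓕₅.graph H)) where
    module P = Presentation P
    module Q = Presentation Q

    Free : Fin P.#blocks → Set
    Free c = ∀ i → ∃[ u ] Q.original u ≡ Block.at (P.block c) i

    Covered : Fin P.#blocks → Set
    Covered c = ∃[ c′ ] ∀ i → Block.In (Q.block c′) (Block.at (P.block c) i)

    meet⇒⊆ : ∀ c c′ {i j} → Block.at (Q.block c′) j ≡ Block.at (P.block c) i →
              ∀ i → Block.In (Q.block c′) (Block.at (P.block c) i)
    meet⇒⊆ c c′ {i} {j} eq = overlap⇒⊆ fc (P.block c) (Q.block c′) (Q.block-open c′)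
      (no-double-leg fc cyc H Q c′) i (j , eq)

    free-or-covered : ∀ c → Free c ⊎ Covered c
    free-or-covered c with ∃-or-∀ {A = λ i → ∃[ c′ ] Block.In (Q.block c′) (Block.at (P.block c) i)}
                                  {B = λ i → ∃[ u ] Q.original u ≡ Block.at (P.block c) i}
                                  (λ i → case Q.vertexView (Block.at (P.block c) i) of λ
                                    { (inj₁ p) → inj₂ p ; (inj₂ p) → inj₁ p })
    ... | inj₁ (i , c′ , j , eq) = inj₂ (c′ , meet⇒⊆ c c′ eq)
    ... | inj₂ free = inj₁ free

    Petersen-≃-other : ∀ c → Free c → Petersen ≃ 𝓕₅.graph H
    Petersen-≃-other c free = Petersen-≃ H (descend Q (P.block c) free)

  module Reconstruct (G H : 𝓕₅) (P : Presentation Γ (𝓕₅.graph G)) (Q : Presentation Γ (𝓕₅.graph H))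
                     (covered : ∀ c → Compare.Covered H G Q P c) where
    open Compare G H P Q using (module P; module Q)
    private
      module PQ = Compare G H P Q
      module QP = Compare H G Q P

    -- A block of `Q` through this vertex would lie in a block of `P`, and those avoid the originals
    -- of `P`.
    vertex : ∀ v → ∃[ u ] Q.original u ≡ P.original v
    vertex v with Q.vertexView (P.original v)
    ... | inj₁ p = p
    ... | inj₂ (c′ , j , eq) with c , sub ← covered c′ with i , eq′ ← sub j =
      contradiction (i , trans eq′ eq) (P.original∉ c v)

    -- By `vertex`, the vertices of `G` are vertices of `H`. They all avoid the block that descends
    -- to `H`, and `block-leaves-two` leaves room for only two.
    few-vertices : ∀ c → ¬ PQ.Free c
    few-vertices c free = ¬AtMostTwo G λ u v w →
      case block-leaves-two H β (away u) (away v) (away w) of λ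
        { (inj₁ p) → inj₁ (same p) ; (inj₂ (inj₁ p)) → inj₂ (inj₁ (same p)) ; (inj₂ (inj₂ p)) → inj₂ (inj₂ (same p)) }
      where
      β : Block (𝓕₅.graph H)
      β = descend Q (P.block c) free
      away : ∀ v → ¬ Block.In β (proj₁ (vertex v))
      away v (i , eq) = P.original∉ c v (i , trans (sym (proj₂ (free i)))
        (trans (cong Q.original eq) (proj₂ (vertex v))))
      same : ∀ {u v} → proj₁ (vertex u) ≡ proj₁ (vertex v) → u ≡ v
      same {u} {v} eq = P.original-injective (trans (sym (proj₂ (vertex u)))
        (trans (cong Q.original eq) (proj₂ (vertex v))))

    dart : ∀ d → ∃[ d′ ] Q.stub d′ ≡ P.stub d
    dart d = Q.stub-cover (P.stub d) (proj₁ (vertex (tail (𝓕₅.graph G) d)))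
      (trans (P.tail-stub d) (sym (proj₂ (vertex _))))

    tail-dart′ : ∀ d → tail (𝓕₅.graph H) (proj₁ (dart d)) ≡ proj₁ (vertex (tail (𝓕₅.graph G) d))
    tail-dart′ d = Q.original-injective (trans (sym (Q.tail-stub _)) (trans (cong (tail Γ) (proj₂ (dart d)))
      (trans (P.tail-stub d) (sym (proj₂ (vertex _))))))

    module _ (covered′ : ∀ c → PQ.Covered c) where

      private
        -- A leg of the first block starts in the second. Were it inner there, it would also end
        -- there and hence, by the reverse containment, in the first block, against openness.
        leg-match : ∀ c c′ → (∀ i → Block.In (Q.block c′) (Block.at (P.block c) i)) →
                    (∀ j → Block.In (P.block c) (Block.at (Q.block c′) j)) →
                    ∀ h → ∃[ h′ ] Block.leg (Q.block c′) h′ ≡ Block.leg (P.block c) h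
        leg-match c c′ sub sup h with sub (foot h)
        ... | j , eq with Block.cover (Q.block c′) (Block.leg (P.block c) h) j
                            (trans (Block.tail-leg (P.block c) h) (sym eq))
        ...   | inj₂ p = p
        ...   | inj₁ (d , eq′) = contradiction
                  (subst (Block.In (P.block c)) (trans (sym (Block.head-inner (Q.block c′) d)) (cong (head Γ) eq′))
                    (sup (head B₀ d))) (P.block-open c h)

        -- If the matching legs of the `Q`-block are partners, `Q.edgeOf-leg` applies. Otherwise
        -- their feet have a common neighbour, which `Adjacent-resp` carries over to the `P`-block,
        -- against `partners-far`.
        leg-edge : ∀ c h → Q.edgeOf (Block.leg (P.block c) h) ≡ Q.edgeOf (Block.leg (P.block c) (partner h))
        leg-edge c h = compare (leg-match c c′ sub sup h) (leg-match c c′ sub sup (partner h))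
          where
          c′ : Fin Q.#blocks
          c′ = proj₁ (covered′ c)
          sub : ∀ i → Block.In (Q.block c′) (Block.at (P.block c) i)
          sub = proj₂ (covered′ c)
          sup : ∀ j → Block.In (P.block c) (Block.at (Q.block c′) j)
          sup = QP.meet⇒⊆ c′ c (sym (proj₂ (sub (foot a))))
          feet : ∀ {h h′} → Block.leg (Q.block c′) h′ ≡ Block.leg (P.block c) h →
                 Block.at (Q.block c′) (foot h′) ≡ Block.at (P.block c) (foot h)
          feet {h} {h′} eq = trans (sym (Block.tail-leg (Q.block c′) h′))
            (trans (cong (tail Γ) eq) (Block.tail-leg (P.block c) h))
          partner≢ : ∀ h → h ≢ partner h
          partner≢ a ()
          partner≢ a′ ()
          partner≢ b ()
          partner≢ b′ ()
          compare : (∃[ k ] Block.leg (Q.block c′) k ≡ Block.leg (P.block c) h) →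
                    (∃[ k ] Block.leg (Q.block c′) k ≡ Block.leg (P.block c) (partner h)) → _
          compare (k , p) (k′ , p′) with common-or-partner k k′
          ... | inj₁ refl = contradiction (Block.leg-injective (P.block c) (trans (sym p) p′)) (partner≢ h)
          ... | inj₂ (inj₁ refl) = trans (cong Q.edgeOf (sym p)) (trans (Q.edgeOf-leg c′ k) (cong Q.edgeOf p′))
          ... | inj₂ (inj₂ (j , kj , jk′)) with i , eq ← sup j = contradiction
            (i , Adjacent-resp (Q.block c′) (P.block c) (P.block-open c) (feet p) (sym eq) kj
               , Adjacent-resp (Q.block c′) (P.block c) (P.block-open c) (sym eq) (feet p′) jk′)
            (partners-far h)

      -- `Q.edgeOf` is followed along an edge of `G`: it is constant on each piece, and `leg-edge`
      -- carries it across each block. So both stubs of `e` belong to one edge of `H`.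
      same-edge′ : ∀ e → proj₁ (proj₁ (dart (e , false))) ≡ proj₁ (proj₁ (dart (e , true)))
      same-edge′ e = just-injective (trans (sym (Q.edgeOf-stub _)) (trans (cong Q.edgeOf (proj₂ (dart (e , false))))
        (trans (P.edge-induction Q.edgeOf Q.edgeOf-opposite leg-edge e)
          (trans (cong Q.edgeOf (sym (proj₂ (dart (e , true))))) (Q.edgeOf-stub _)))))

      opposite-dart : ∀ d → proj₁ (dart (opposite (𝓕₅.graph G) d)) ≡ opposite (𝓕₅.graph H) (proj₁ (dart d))
      opposite-dart d with same-edge (𝓕₅.graph H) (proj₁ (dart d)) (proj₁ (dart (opposite (𝓕₅.graph G) d))) (along d)
        where
        along : ∀ d → proj₁ (proj₁ (dart d)) ≡ proj₁ (proj₁ (dart (opposite (𝓕₅.graph G) d)))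
        along (e , false) = same-edge′ e
        along (e , true)  = sym (same-edge′ e)
      ... | inj₂ p = p
      ... | inj₁ p = contradiction (P.stub-injective (trans (sym (proj₂ (dart _)))
              (trans (cong Q.stub p) (proj₂ (dart d))))) (opposite≢ (𝓕₅.graph G) d)

  presentations⇒≃ : (G H : 𝓕₅) → Presentation Γ (𝓕₅.graph G) → Presentation Γ (𝓕₅.graph H) →
                    𝓕₅.graph G ≃ 𝓕₅.graph H
  presentations⇒≃ G H P Q with ∃-or-∀ (Compare.free-or-covered G H P Q) | ∃-or-∀ (Compare.free-or-covered H G Q P)
  -- Each graph contains a block coming from the other, so both are the Petersen graph.
  ... | inj₁ (c , p) | inj₁ (c′ , q) =
    ≃-trans (≃-sym (Compare.Petersen-≃-other H G Q P c′ q)) (Compare.Petersen-≃-other G H P Q c p)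
  ... | inj₁ (c , p) | inj₂ q = contradiction p (Reconstruct.few-vertices G H P Q q c)
  ... | inj₂ p | inj₁ (c , q) = contradiction q (Reconstruct.few-vertices H G Q P p c)
  ... | inj₂ p | inj₂ q = record
    { to = proj₁ ∘ PQ.vertex ; from = proj₁ ∘ QP.vertex
    ; from-to = λ v → Presentation.original-injective P
        (trans (proj₂ (QP.vertex _)) (proj₂ (PQ.vertex v)))
    ; to-from = λ v → Presentation.original-injective Q
        (trans (proj₂ (PQ.vertex _)) (proj₂ (QP.vertex v)))
    ; toᴰ = proj₁ ∘ PQ.dart ; fromᴰ = proj₁ ∘ QP.dart
    ; fromᴰ-toᴰ = λ d → Presentation.stub-injective P (trans (proj₂ (QP.dart _)) (proj₂ (PQ.dart d)))
    ; toᴰ-fromᴰ = λ d → Presentation.stub-injective Q (trans (proj₂ (PQ.dart _)) (proj₂ (QP.dart d)))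
    ; tail-toᴰ = PQ.tail-dart′ ; opposite-toᴰ = PQ.opposite-dart p }
    where
    module PQ = Reconstruct G H P Q q
    module QP = Reconstruct H G Q P p

theorem11 : (M : (G : 𝓕₅) → PerfectPseudoMatching (𝓕₅.graph G)) →
    (D : (G : 𝓕₅) → WiredDrawing (𝓕₅.graph G) (M G)) →
    (f : 𝓕₅ → 𝓕₄) →
    (∀ G → 𝓕₄.graph (f G) ≅ D G *) →
    Injective _≅₅_ _≅₄_ f
-- The common graph is `𝓕₄.graph (f H)`; its finiteness, cubicity and cyclic 4-edge-connectivity
-- come from membership in `𝓕₄`.
theorem11 M D f star {G} {H} φ = ≃⇒≅ (presentations⇒≃ (finiteCubic (𝓕₄.snark (f H)))
  (Snark.cyclically-4-edge-connected (𝓕₄.snark (f H))) G H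
  (Presentation-transport (≅⇒≃ φ) (starred G)) (starred H))
  where
  starred : ∀ G → Presentation (𝓕₄.graph (f G)) (𝓕₅.graph G)
  starred G = Presentation-transport (≃-sym (≅⇒≃ (star G)))
    (presentation (Drawing.crossings (WiredDrawing.drawing (D G))) (WiredDrawing.wiring (D G)))
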